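{- Let $r\ge 1$ and let $\{R_{\alpha,n}\}_{0\le\alpha\le r+1,\ n\in\mathbb Z}$ be the solution of the $A_r$ $Q$-system with initial data $(R_{\alpha,0},R_{\alpha,1})_{1\le \alpha\le r}$. Then for all $n\ge 0$, $$R_{1,n+1}=R_{1,1}\sum_{\substack{p_1,\dots,p_{2r+1}\ge 0\\ p_1+\cdots+p_{2r+1}=n}}\ \prod_{i=1}^{r}\frac{(R_{i,0})^{p_{2i+2}+p_{2i+1}-p_{2i}-p_{2i-1}}}{(R_{i,1})^{p_{2i+1}+p_{2i}-p_{2i-1}-p_{2i-2}}}\ \binom{p_1+p_2}{p_1}\prod_{\ell=1}^{r}C(p_{2\ell},p_{2\ell+1},p_{2\ell+2}),$$ where $p_0=p_{2r+2}=0$ and, for integers $a,b,c\ge 0$, $$C(a,b,c)=\begin{cases}\dfrac{(a+b+c-1)!}{(a-1)!\,b!\,c!}& a\ge 1,\\ 1& a=b=c=0,\\ 0& a=0,\ (b,c)\neq(0,0).\end{cases}$$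
   Context: The $A_r$ $Q$-system is the system of recursion relations $R_{\alpha,n+1}R_{\alpha,n-1}=R_{\alpha,n}^2+R_{\alpha+1,n}R_{\alpha-1,n}$ for $1\le\alpha\le r$ and $n\in\mathbb Z$, with boundary conditions $R_{0,n}=R_{r+1,n}=1$ for all $n\in\mathbb Z$. The initial data $R_{\alpha,0},R_{\alpha,1}$ ($1\le\alpha\le r$) are independent indeterminates, and all $R_{\alpha,n}$ lie in the field of rational functions in them. -}

module Defs where

open import Level using (0ℓ)
open import Algebra.Bundles using (CommutativeRing)
open import Data.Nat as ℕ using (ℕ; zero; suc; _!; _≤_)
open import Data.Nat.Properties as ℕₚ using (_!≢0; m*n≢0)
open import Data.Integer as ℤ using (ℤ; +_; -[1+_]; 0ℤ; 1ℤ)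
open import Data.Rational as ℚ using (ℚ; 0ℚ)
import Data.Rational.Properties as ℚₚ
open import Data.Fin using (Fin; zero; suc; toℕ; _↑ˡ_; _↑ʳ_)
open import Data.List using (List; []; _∷_; map; foldr; concatMap; upTo)
open import Data.Vec using (Vec; []; _∷_)
open import Data.Product using (_×_; _,_)
open import Data.Sum as Sum using (_⊎_; inj₁; inj₂)
open import Relation.Nullary using (¬_; Dec; yes; no; contradiction)
import Relation.Nullary.Decidable as Dec
open import Relation.Binary using (Setoid; IsEquivalence)
open import Relation.Binary.PropositionalEquality as ≡ using (_≡_; _≢_)
import Relation.Binary.Reasoning.Setoid
import Algebra.Properties.Ring
import Algebra.Properties.Semiring.Exp
import Algebra.Properties.Semiring.Mult
import Algebra.Solver.Ring.NaturalCoefficients.Default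

record DiscreteDomain : Set₁ where
  field
    commutativeRing : CommutativeRing 0ℓ 0ℓ
  open CommutativeRing commutativeRing public
  field
    _≟_             : ∀ x y → Dec (x ≈ y)
    1≉0             : ¬ 1# ≈ 0#
    noZeroDivisors  : ∀ x y → x * y ≈ 0# → x ≈ 0# ⊎ y ≈ 0#

ℚ-domain : DiscreteDomain
ℚ-domain = record
  { commutativeRing = ℚₚ.+-*-commutativeRing
  ; _≟_             = ℚ._≟_
  ; 1≉0             = λ ()
  ; noZeroDivisors  = zeroProduct
  }
  where
  zeroProduct : ∀ x y → x ℚ.* y ≡ 0ℚ → x ≡ 0ℚ ⊎ y ≡ 0ℚ
  zeroProduct x y xy≡0 with x ℚ.≟ 0ℚ
  ... | yes x≡0 = inj₁ x≡0
  ... | no  x≢0 = inj₂ (begin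
    y                    ≡⟨ ℚₚ.*-identityˡ y ⟨
    ℚ.1ℚ ℚ.* y           ≡⟨ ≡.cong (ℚ._* y) (ℚₚ.*-inverseˡ x) ⟨
    ℚ.1/ x ℚ.* x ℚ.* y   ≡⟨ ℚₚ.*-assoc (ℚ.1/ x) x y ⟩
    ℚ.1/ x ℚ.* (x ℚ.* y) ≡⟨ ≡.cong (ℚ.1/ x ℚ.*_) xy≡0 ⟩
    ℚ.1/ x ℚ.* 0ℚ        ≡⟨ ℚₚ.*-zeroʳ (ℚ.1/ x) ⟩
    0ℚ                   ∎)
    where
    open ≡.≡-Reasoning
    instance _ = ℚ.≢-nonZero x≢0

-- The polynomial ring D[t]: a ∷ p stands for a + t p, and lists are
-- compared coefficientwise, so trailing zeros are irrelevant.
module Polynomial (D : DiscreteDomain) where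
  private module D = DiscreteDomain D
  open D using () renaming (Carrier to A)

  Poly : Set
  Poly = List A

  coeff : Poly → ℕ → A
  coeff []      _       = D.0#
  coeff (a ∷ p) zero    = a
  coeff (a ∷ p) (suc k) = coeff p k

  infix 4 _≈_
  record _≈_ (p q : Poly) : Set where
    constructor mk≈
    field at : ∀ k → coeff p k D.≈ coeff q k
  open _≈_ public

  infixl 6 _+_
  infixl 7 _*_
  infixr 8 _·_

  _+_ : Poly → Poly → Poly
  []      + q       = q
  (a ∷ p) + []      = a ∷ p
  (a ∷ p) + (b ∷ q) = a D.+ b ∷ p + q

  -_ : Poly → Poly
  - p = map D.-_ p

  _·_ : A → Poly → Poly
  a · p = map (a D.*_) p

  shift : Poly → Poly
  shift p = D.0# ∷ p

  _*_ : Poly → Poly → Poly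
  []      * q = []
  (a ∷ p) * q = a · q + shift (p * q)

  constant : A → Poly
  constant a = a ∷ []

  variable-t : Poly
  variable-t = D.0# ∷ D.1# ∷ []

  module Properties where
    private module DP = Algebra.Properties.Ring D.ring

    coeff-+ : ∀ p q k → coeff (p + q) k D.≈ coeff p k D.+ coeff q k
    coeff-+ []      q       k       = D.sym (D.+-identityˡ _)
    coeff-+ (a ∷ p) []      k       = D.sym (D.+-identityʳ _)
    coeff-+ (a ∷ p) (b ∷ q) zero    = D.refl
    coeff-+ (a ∷ p) (b ∷ q) (suc k) = coeff-+ p q k

    coeff-neg : ∀ p k → coeff (- p) k D.≈ D.- coeff p k
    coeff-neg []      k       = D.sym DP.-0#≈0#
    coeff-neg (a ∷ p) zero    = D.refl
    coeff-neg (a ∷ p) (suc k) = coeff-neg p k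

    coeff-· : ∀ a p k → coeff (a · p) k D.≈ a D.* coeff p k
    coeff-· a []      k       = D.sym (D.zeroʳ a)
    coeff-· a (b ∷ p) zero    = D.refl
    coeff-· a (b ∷ p) (suc k) = coeff-· a p k

    refl : ∀ {p} → p ≈ p
    refl = mk≈ λ _ → D.refl

    sym : ∀ {p q} → p ≈ q → q ≈ p
    sym e = mk≈ λ k → D.sym (at e k)

    trans : ∀ {p q s} → p ≈ q → q ≈ s → p ≈ s
    trans e f = mk≈ λ k → D.trans (at e k) (at f k)

    isEquivalence : IsEquivalence _≈_
    isEquivalence = record { refl = refl ; sym = sym ; trans = trans }

    setoid : Setoid 0ℓ 0ℓ
    setoid = record { isEquivalence = isEquivalence }

    module ≈-Reasoning = Relation.Binary.Reasoning.Setoid setoid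

    +-cong : ∀ {p p′ q q′} → p ≈ p′ → q ≈ q′ → p + q ≈ p′ + q′
    +-cong {p} {p′} {q} {q′} e f = mk≈ λ k →
      D.trans (coeff-+ p q k)
        (D.trans (D.+-cong (at e k) (at f k)) (D.sym (coeff-+ p′ q′ k)))

    +-assoc : ∀ p q s → (p + q) + s ≈ p + (q + s)
    +-assoc p q s = mk≈ λ k →
      D.trans (coeff-+ (p + q) s k)
        (D.trans (D.+-congʳ (coeff-+ p q k))
          (D.trans (D.+-assoc _ _ _)
            (D.trans (D.+-congˡ (D.sym (coeff-+ q s k)))
              (D.sym (coeff-+ p (q + s) k)))))

    +-comm : ∀ p q → p + q ≈ q + p
    +-comm p q = mk≈ λ k →
      D.trans (coeff-+ p q k)
        (D.trans (D.+-comm _ _) (D.sym (coeff-+ q p k)))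

    +-identityʳ : ∀ p → p + [] ≈ p
    +-identityʳ []      = refl
    +-identityʳ (a ∷ p) = refl

    -‿cong : ∀ {p q} → p ≈ q → - p ≈ - q
    -‿cong {p} {q} e = mk≈ λ k →
      D.trans (coeff-neg p k)
        (D.trans (D.-‿cong (at e k)) (D.sym (coeff-neg q k)))

    -‿inverseʳ : ∀ p → p + (- p) ≈ []
    -‿inverseʳ p = mk≈ λ k →
      D.trans (coeff-+ p (- p) k)
        (D.trans (D.+-congˡ (coeff-neg p k)) (D.-‿inverseʳ _))

    -‿inverseˡ : ∀ p → (- p) + p ≈ []
    -‿inverseˡ p = trans (+-comm (- p) p) (-‿inverseʳ p)

    +-interchange : ∀ p q s t → (p + q) + (s + t) ≈ (p + s) + (q + t)
    +-interchange p q s t = begin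
      (p + q) + (s + t) ≈⟨ +-assoc p q (s + t) ⟩
      p + (q + (s + t)) ≈⟨ +-cong (refl {p}) (sym (+-assoc q s t)) ⟩
      p + ((q + s) + t) ≈⟨ +-cong (refl {p}) (+-cong (+-comm q s) (refl {t})) ⟩
      p + ((s + q) + t) ≈⟨ +-cong (refl {p}) (+-assoc s q t) ⟩
      p + (s + (q + t)) ≈⟨ +-assoc p s (q + t) ⟨
      (p + s) + (q + t) ∎
      where open ≈-Reasoning

    ∷-cong : ∀ {a b p q} → a D.≈ b → p ≈ q → a ∷ p ≈ b ∷ q
    ∷-cong a≈b e = mk≈ λ { zero → a≈b ; (suc k) → at e k }

    head-≈ : ∀ {a b p q} → a ∷ p ≈ b ∷ q → a D.≈ b
    head-≈ e = at e 0

    tail-≈ : ∀ {a b p q} → a ∷ p ≈ b ∷ q → p ≈ q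
    tail-≈ e = mk≈ λ k → at e (suc k)

    shift-cong : ∀ {p q} → p ≈ q → shift p ≈ shift q
    shift-cong = ∷-cong D.refl

    shift-[] : shift [] ≈ []
    shift-[] = mk≈ λ { zero → D.refl ; (suc k) → D.refl }

    shift-+ : ∀ p q → shift (p + q) ≈ shift p + shift q
    shift-+ p q = ∷-cong (D.sym (D.+-identityˡ _)) refl

    ·-cong : ∀ {a b p q} → a D.≈ b → p ≈ q → a · p ≈ b · q
    ·-cong {a} {b} {p} {q} a≈b e = mk≈ λ k →
      D.trans (coeff-· a p k)
        (D.trans (D.*-cong a≈b (at e k)) (D.sym (coeff-· b q k)))

    ·-zero : ∀ {a} p → a D.≈ D.0# → a · p ≈ []
    ·-zero {a} p a≈0 = mk≈ λ k →
      D.trans (coeff-· a p k) (D.trans (D.*-congʳ a≈0) (D.zeroˡ _))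

    ·-one : ∀ p → D.1# · p ≈ p
    ·-one p = mk≈ λ k → D.trans (coeff-· D.1# p k) (D.*-identityˡ _)

    ·-+ : ∀ a p q → a · (p + q) ≈ a · p + a · q
    ·-+ a p q = mk≈ λ k →
      D.trans (coeff-· a (p + q) k)
        (D.trans (D.*-congˡ (coeff-+ p q k))
          (D.trans (D.distribˡ _ _ _)
            (D.trans (D.sym (D.+-cong (coeff-· a p k) (coeff-· a q k)))
              (D.sym (coeff-+ (a · p) (a · q) k)))))

    +-· : ∀ a b p → (a D.+ b) · p ≈ a · p + b · p
    +-· a b p = mk≈ λ k →
      D.trans (coeff-· (a D.+ b) p k)
        (D.trans (D.distribʳ _ _ _)
          (D.trans (D.sym (D.+-cong (coeff-· a p k) (coeff-· b p k)))
            (D.sym (coeff-+ (a · p) (b · p) k))))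

    ·-· : ∀ a b p → a · (b · p) ≈ (a D.* b) · p
    ·-· a b p = mk≈ λ k →
      D.trans (coeff-· a (b · p) k)
        (D.trans (D.*-congˡ (coeff-· b p k))
          (D.trans (D.sym (D.*-assoc _ _ _)) (D.sym (coeff-· (a D.* b) p k))))

    ·-shift : ∀ a p → a · shift p ≈ shift (a · p)
    ·-shift a p = ∷-cong (D.zeroʳ a) refl

    *-zeroˡ : ∀ p q → p ≈ [] → p * q ≈ []
    *-zeroˡ []      q e = refl
    *-zeroˡ (a ∷ p) q e = begin
      a · q + shift (p * q) ≈⟨ +-cong (·-zero q (at e 0)) (shift-cong
                                 (*-zeroˡ p q (mk≈ λ k → at e (suc k)))) ⟩
      shift []              ≈⟨ shift-[] ⟩
      []                    ∎
      where open ≈-Reasoning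

    *-zeroʳ : ∀ p → p * [] ≈ []
    *-zeroʳ []      = refl
    *-zeroʳ (a ∷ p) = trans (shift-cong (*-zeroʳ p)) shift-[]

    *-congʳ : ∀ p p′ q → p ≈ p′ → p * q ≈ p′ * q
    *-congʳ []      p′       q e = sym (*-zeroˡ p′ q (sym e))
    *-congʳ (a ∷ p) []       q e = *-zeroˡ (a ∷ p) q e
    *-congʳ (a ∷ p) (b ∷ p′) q e =
      +-cong (·-cong (head-≈ e) (refl {q})) (shift-cong (*-congʳ p p′ q (tail-≈ e)))

    *-∷ : ∀ p b q → p * (b ∷ q) ≈ b · p + shift (p * q)
    *-∷ []      b q = sym shift-[]
    *-∷ (a ∷ p) b q = ∷-cong
      (D.+-congʳ (D.*-comm a b))
      (begin
        a · q + p * (b ∷ q)             ≈⟨ +-cong (refl {a · q}) (*-∷ p b q) ⟩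
        a · q + (b · p + shift (p * q)) ≈⟨ +-assoc (a · q) _ _ ⟨
        (a · q + b · p) + shift (p * q) ≈⟨ +-cong (+-comm (a · q) _) refl ⟩
        (b · p + a · q) + shift (p * q) ≈⟨ +-assoc (b · p) _ _ ⟩
        b · p + (a · q + shift (p * q)) ∎)
      where open ≈-Reasoning

    *-comm : ∀ p q → p * q ≈ q * p
    *-comm []      q = sym (*-zeroʳ q)
    *-comm (a ∷ p) q = begin
      a · q + shift (p * q) ≈⟨ +-cong (refl {a · q}) (shift-cong (*-comm p q)) ⟩
      a · q + shift (q * p) ≈⟨ *-∷ q a p ⟨
      q * (a ∷ p)           ∎
      where open ≈-Reasoning

    *-cong : ∀ {p p′ q q′} → p ≈ p′ → q ≈ q′ → p * q ≈ p′ * q′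
    *-cong {p} {p′} {q} {q′} e f = begin
      p * q   ≈⟨ *-congʳ p p′ q e ⟩
      p′ * q  ≈⟨ *-comm p′ q ⟩
      q * p′  ≈⟨ *-congʳ q q′ p′ f ⟩
      q′ * p′ ≈⟨ *-comm q′ p′ ⟩
      p′ * q′ ∎
      where open ≈-Reasoning

    *-distribʳ : ∀ s p q → (p + q) * s ≈ p * s + q * s
    *-distribʳ s []      q       = refl
    *-distribʳ s (a ∷ p) []      = sym (+-identityʳ _)
    *-distribʳ s (a ∷ p) (b ∷ q) = begin
      (a D.+ b) · s + shift ((p + q) * s)
        ≈⟨ +-cong (+-· a b s) (trans (shift-cong (*-distribʳ s p q)) (shift-+ (p * s) (q * s))) ⟩
      (a · s + b · s) + (shift (p * s) + shift (q * s))
        ≈⟨ +-interchange (a · s) _ _ _ ⟩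
      (a · s + shift (p * s)) + (b · s + shift (q * s)) ∎
      where open ≈-Reasoning

    *-distribˡ : ∀ s p q → s * (p + q) ≈ s * p + s * q
    *-distribˡ s p q = begin
      s * (p + q)   ≈⟨ *-comm s (p + q) ⟩
      (p + q) * s   ≈⟨ *-distribʳ s p q ⟩
      p * s + q * s ≈⟨ +-cong (*-comm p s) (*-comm q s) ⟩
      s * p + s * q ∎
      where open ≈-Reasoning

    ·-* : ∀ a p q → (a · p) * q ≈ a · (p * q)
    ·-* a []      q = refl
    ·-* a (b ∷ p) q = begin
      (a D.* b) · q + shift ((a · p) * q)
        ≈⟨ +-cong (sym (·-· a b q)) (trans (shift-cong (·-* a p q)) (sym (·-shift a (p * q)))) ⟩
      a · (b · q) + a · shift (p * q)
        ≈⟨ ·-+ a (b · q) (shift (p * q)) ⟨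
      a · (b · q + shift (p * q)) ∎
      where open ≈-Reasoning

    shift-* : ∀ p q → shift p * q ≈ shift (p * q)
    shift-* p q = +-cong (·-zero q D.refl) refl

    *-assoc : ∀ p q s → (p * q) * s ≈ p * (q * s)
    *-assoc []      q s = refl
    *-assoc (a ∷ p) q s = begin
      (a · q + shift (p * q)) * s       ≈⟨ *-distribʳ s (a · q) (shift (p * q)) ⟩
      (a · q) * s + shift (p * q) * s   ≈⟨ +-cong (·-* a q s) (trans (shift-* (p * q) s)
                                             (shift-cong (*-assoc p q s))) ⟩
      a · (q * s) + shift (p * (q * s)) ∎
      where open ≈-Reasoning

    *-identityˡ : ∀ p → constant D.1# * p ≈ p
    *-identityˡ p = begin
      D.1# · p + shift [] ≈⟨ +-cong (·-one p) shift-[] ⟩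
      p + []              ≈⟨ +-identityʳ p ⟩
      p                   ∎
      where open ≈-Reasoning

    *-identityʳ : ∀ p → p * constant D.1# ≈ p
    *-identityʳ p = trans (*-comm p (constant D.1#)) (*-identityˡ p)

    _≟_ : ∀ p q → Dec (p ≈ q)
    []      ≟ []      = yes refl
    []      ≟ (b ∷ q) with D.0# D.≟ b | [] ≟ q
    ... | yes e | yes f = yes (mk≈ λ { zero → e ; (suc k) → at f k })
    ... | no ¬e | _     = no λ f → ¬e (at f 0)
    ... | _     | no ¬f = no λ f → ¬f (mk≈ λ k → at f (suc k))
    (a ∷ p) ≟ []      with a D.≟ D.0# | p ≟ []
    ... | yes e | yes f = yes (mk≈ λ { zero → e ; (suc k) → at f k })
    ... | no ¬e | _     = no λ f → ¬e (at f 0)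
    ... | _     | no ¬f = no λ f → ¬f (mk≈ λ k → at f (suc k))
    (a ∷ p) ≟ (b ∷ q) with a D.≟ b | p ≟ q
    ... | yes e | yes f = yes (∷-cong e f)
    ... | no ¬e | _     = no λ f → ¬e (head-≈ f)
    ... | _     | no ¬f = no λ f → ¬f (tail-≈ f)

    zeroProduct-∷ : ∀ a p b q →
      (p * (b ∷ q) ≈ [] → p ≈ [] ⊎ b ∷ q ≈ []) →
      ((a ∷ p) * q ≈ [] → a ∷ p ≈ [] ⊎ q ≈ []) →
      (a ∷ p) * (b ∷ q) ≈ [] → a ∷ p ≈ [] ⊎ b ∷ q ≈ []
    zeroProduct-∷ a p b q recˡ recʳ e with a D.≟ D.0# | b D.≟ D.0#
    ... | yes a≈0 | _       = Sum.map₁ (λ f → trans (∷-cong a≈0 f) shift-[])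
      (recˡ (mk≈ λ k → at (trans (sym (shift-* p (b ∷ q)))
        (trans (*-congʳ (shift p) (a ∷ p) (b ∷ q) (∷-cong (D.sym a≈0) refl)) e)) (suc k)))
    ... | no _    | yes b≈0 = Sum.map₂ (λ f → trans (∷-cong b≈0 f) shift-[])
      (recʳ (mk≈ λ k → at (trans (sym (+-cong (·-zero (a ∷ p) b≈0) (refl {shift ((a ∷ p) * q)})))
        (trans (sym (*-∷ (a ∷ p) b q)) e)) (suc k)))
    ... | no a≉0  | no b≉0  with D.noZeroDivisors a b (D.trans (D.sym (D.+-identityʳ _)) (at e 0))
    ...   | inj₁ a≈0 = contradiction a≈0 a≉0
    ...   | inj₂ b≈0 = contradiction b≈0 b≉0

    zeroProduct : ∀ p q → p * q ≈ [] → p ≈ [] ⊎ q ≈ []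
    zeroProduct []      q       e = inj₁ refl
    zeroProduct (a ∷ p) []      e = inj₂ refl
    zeroProduct (a ∷ p) (b ∷ q) e =
      zeroProduct-∷ a p b q (zeroProduct p (b ∷ q)) (zeroProduct (a ∷ p) q) e

  open Properties

  domain : DiscreteDomain
  domain = record
    { commutativeRing = record
      { Carrier = Poly
      ; _≈_     = _≈_
      ; _+_     = _+_
      ; _*_     = _*_
      ; -_      = -_
      ; 0#      = []
      ; 1#      = constant D.1#
      ; isCommutativeRing = record
        { isRing = record
          { +-isAbelianGroup = record
            { isGroup = record
              { isMonoid = record
                { isSemigroup = record
                  { isMagma = record
                    { isEquivalence = isEquivalence
                    ; ∙-cong        = +-cong
                    }
                  ; assoc = +-assoc
                  }
                ; identity = (λ _ → refl) , +-identityʳ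
                }
              ; inverse = -‿inverseˡ , -‿inverseʳ
              ; ⁻¹-cong = -‿cong
              }
            ; comm = +-comm
            }
          ; *-cong     = *-cong
          ; *-assoc    = *-assoc
          ; *-identity = *-identityˡ , *-identityʳ
          ; distrib    = *-distribˡ , *-distribʳ
          }
        ; *-comm = *-comm
        }
      }
    ; _≟_            = _≟_
    ; 1≉0            = λ e → D.1≉0 (at e 0)
    ; noZeroDivisors = zeroProduct
    }

module FieldOfFractions (D : DiscreteDomain) where
  private module D = DiscreteDomain D
  open D using () renaming (Carrier to A)

  record Fraction : Set where
    constructor _/_[_]
    field
      num   : A
      den   : A
      den≉0 : ¬ den D.≈ D.0#
  open Fraction public

  infix 4 _≈_
  record _≈_ (x y : Fraction) : Set where
    constructor mk≈
    field cross : num x D.* den y D.≈ num y D.* den x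
  open _≈_ public

  *-nonzero : ∀ {a b} → ¬ a D.≈ D.0# → ¬ b D.≈ D.0# → ¬ (a D.* b) D.≈ D.0#
  *-nonzero {a} {b} a≉0 b≉0 e with D.noZeroDivisors a b e
  ... | inj₁ a≈0 = a≉0 a≈0
  ... | inj₂ b≈0 = b≉0 b≈0

  infix  8 -_ _⁻¹
  infixl 7 _*_
  infixl 6 _+_

  _+_ : Fraction → Fraction → Fraction
  (a / b [ b≉0 ]) + (c / d [ d≉0 ]) =
    (a D.* d D.+ c D.* b) / (b D.* d) [ *-nonzero b≉0 d≉0 ]

  _*_ : Fraction → Fraction → Fraction
  (a / b [ b≉0 ]) * (c / d [ d≉0 ]) =
    (a D.* c) / (b D.* d) [ *-nonzero b≉0 d≉0 ]

  -_ : Fraction → Fraction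
  - (a / b [ b≉0 ]) = (D.- a) / b [ b≉0 ]

  fromDomain : A → Fraction
  fromDomain a = a / D.1# [ D.1≉0 ]

  0# 1# : Fraction
  0# = fromDomain D.0#
  1# = fromDomain D.1#

  -- Total inverse, with the convention that the inverse of zero is zero.
  _⁻¹ : Fraction → Fraction
  (a / b [ _ ]) ⁻¹ with a D.≟ D.0#
  ... | yes _   = 0#
  ... | no  a≉0 = b / a [ a≉0 ]

  private
    open Algebra.Solver.Ring.NaturalCoefficients.Default D.commutativeSemiring
      using (solve; _:=_; _:+_; _:*_; con)
    module DP = Algebra.Properties.Ring D.ring
    module ≈-Reasoning = Relation.Binary.Reasoning.Setoid D.setoid

    cancelʳ : ∀ a b c → ¬ c D.≈ D.0# → a D.* c D.≈ b D.* c → a D.≈ b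
    cancelʳ a b c c≉0 e with D.noZeroDivisors (a D.- b) c (begin
      (a D.- b) D.* c             ≈⟨ D.distribʳ c a (D.- b) ⟩
      a D.* c D.+ (D.- b) D.* c   ≈⟨ D.+-cong e (D.sym (DP.-‿distribˡ-* b c)) ⟩
      b D.* c D.- b D.* c         ≈⟨ D.-‿inverseʳ _ ⟩
      D.0#                        ∎)
      where open ≈-Reasoning
    ... | inj₁ a-b≈0 = DP.x∙y⁻¹≈ε⇒x≈y a b a-b≈0
    ... | inj₂ c≈0   = contradiction c≈0 c≉0

    refl : ∀ {x} → x ≈ x
    refl = mk≈ D.refl

    sym : ∀ {x y} → x ≈ y → y ≈ x
    sym e = mk≈ (D.sym (cross e))

    trans : ∀ {x y z} → x ≈ y → y ≈ z → x ≈ z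
    trans {a / b [ _ ]} {c / d [ d≉0 ]} {e / f [ _ ]} p q =
      mk≈ (cancelʳ (a D.* f) (e D.* b) d d≉0 (begin
        a D.* f D.* d ≈⟨ solve 3 (λ a f d → a :* f :* d := a :* d :* f) D.refl a f d ⟩
        a D.* d D.* f ≈⟨ D.*-congʳ (cross p) ⟩
        c D.* b D.* f ≈⟨ solve 3 (λ c b f → c :* b :* f := c :* f :* b) D.refl c b f ⟩
        c D.* f D.* b ≈⟨ D.*-congʳ (cross q) ⟩
        e D.* d D.* b ≈⟨ solve 3 (λ e d b → e :* d :* b := e :* b :* d) D.refl e d b ⟩
        e D.* b D.* d ∎))
      where open ≈-Reasoning

    +-cong : ∀ {x x′ y y′} → x ≈ x′ → y ≈ y′ → x + y ≈ x′ + y′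
    +-cong {a / b [ _ ]} {a′ / b′ [ _ ]} {c / d [ _ ]} {c′ / d′ [ _ ]} p q = mk≈ (begin
      (a D.* d D.+ c D.* b) D.* (b′ D.* d′)
        ≈⟨ solve 6 (λ a b c d b′ d′ → (a :* d :+ c :* b) :* (b′ :* d′)
             := (a :* b′) :* (d :* d′) :+ (c :* d′) :* (b :* b′)) D.refl a b c d b′ d′ ⟩
      a D.* b′ D.* (d D.* d′) D.+ c D.* d′ D.* (b D.* b′)
        ≈⟨ D.+-cong (D.*-congʳ (cross p)) (D.*-congʳ (cross q)) ⟩
      a′ D.* b D.* (d D.* d′) D.+ c′ D.* d D.* (b D.* b′)
        ≈⟨ solve 6 (λ a′ b′ c′ d′ b d → (a′ :* b) :* (d :* d′) :+ (c′ :* d) :* (b :* b′)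
             := (a′ :* d′ :+ c′ :* b′) :* (b :* d)) D.refl a′ b′ c′ d′ b d ⟩
      (a′ D.* d′ D.+ c′ D.* b′) D.* (b D.* d) ∎)
      where open ≈-Reasoning

    *-cong : ∀ {x x′ y y′} → x ≈ x′ → y ≈ y′ → x * y ≈ x′ * y′
    *-cong {a / b [ _ ]} {a′ / b′ [ _ ]} {c / d [ _ ]} {c′ / d′ [ _ ]} p q = mk≈ (begin
      (a D.* c) D.* (b′ D.* d′)
        ≈⟨ solve 4 (λ a c b′ d′ → (a :* c) :* (b′ :* d′) := (a :* b′) :* (c :* d′))
             D.refl a c b′ d′ ⟩
      (a D.* b′) D.* (c D.* d′)
        ≈⟨ D.*-cong (cross p) (cross q) ⟩
      (a′ D.* b) D.* (c′ D.* d)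
        ≈⟨ solve 4 (λ a′ c′ b d → (a′ :* b) :* (c′ :* d) := (a′ :* c′) :* (b :* d))
             D.refl a′ c′ b d ⟩
      (a′ D.* c′) D.* (b D.* d) ∎)
      where open ≈-Reasoning

    -‿cong : ∀ {x y} → x ≈ y → - x ≈ - y
    -‿cong {a / b [ _ ]} {c / d [ _ ]} p = mk≈ (begin
      (D.- a) D.* d ≈⟨ DP.-‿distribˡ-* a d ⟨
      D.- (a D.* d) ≈⟨ D.-‿cong (cross p) ⟩
      D.- (c D.* b) ≈⟨ DP.-‿distribˡ-* c b ⟩
      (D.- c) D.* b ∎)
      where open ≈-Reasoning

    +-assoc : ∀ x y z → (x + y) + z ≈ x + (y + z)
    +-assoc (a / b [ _ ]) (c / d [ _ ]) (e / f [ _ ]) = mk≈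
      (solve 6 (λ a b c d e f →
        ((a :* d :+ c :* b) :* f :+ e :* (b :* d)) :* (b :* (d :* f))
        := (a :* (d :* f) :+ (c :* f :+ e :* d) :* b) :* ((b :* d) :* f))
        D.refl a b c d e f)

    +-comm : ∀ x y → x + y ≈ y + x
    +-comm (a / b [ _ ]) (c / d [ _ ]) = mk≈
      (solve 4 (λ a b c d → (a :* d :+ c :* b) :* (d :* b) := (c :* b :+ a :* d) :* (b :* d))
        D.refl a b c d)

    +-identityˡ : ∀ x → 0# + x ≈ x
    +-identityˡ (a / b [ _ ]) = mk≈
      (solve 2 (λ a b → (con 0 :* b :+ a :* con 1) :* b := a :* (con 1 :* b)) D.refl a b)

    +-identityʳ : ∀ x → x + 0# ≈ x
    +-identityʳ x = trans (+-comm x 0#) (+-identityˡ x)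

    -‿inverseʳ : ∀ x → x + (- x) ≈ 0#
    -‿inverseʳ (a / b [ _ ]) = mk≈ (begin
      (a D.* b D.+ (D.- a) D.* b) D.* D.1# ≈⟨ D.*-identityʳ _ ⟩
      a D.* b D.+ (D.- a) D.* b            ≈⟨ D.distribʳ b a (D.- a) ⟨
      (a D.- a) D.* b                      ≈⟨ D.*-congʳ (D.-‿inverseʳ a) ⟩
      D.0# D.* b                           ≈⟨ D.zeroˡ b ⟩
      D.0#                                 ≈⟨ D.zeroˡ (b D.* b) ⟨
      D.0# D.* (b D.* b)                   ∎)
      where open ≈-Reasoning

    -‿inverseˡ : ∀ x → (- x) + x ≈ 0#
    -‿inverseˡ x = trans (+-comm (- x) x) (-‿inverseʳ x)

    *-assoc : ∀ x y z → (x * y) * z ≈ x * (y * z)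
    *-assoc (a / b [ _ ]) (c / d [ _ ]) (e / f [ _ ]) = mk≈
      (solve 6 (λ a b c d e f → ((a :* c) :* e) :* (b :* (d :* f))
        := (a :* (c :* e)) :* ((b :* d) :* f)) D.refl a b c d e f)

    *-comm : ∀ x y → x * y ≈ y * x
    *-comm (a / b [ _ ]) (c / d [ _ ]) = mk≈
      (solve 4 (λ a b c d → (a :* c) :* (d :* b) := (c :* a) :* (b :* d)) D.refl a b c d)

    *-identityˡ : ∀ x → 1# * x ≈ x
    *-identityˡ (a / b [ _ ]) = mk≈
      (solve 2 (λ a b → (con 1 :* a) :* b := a :* (con 1 :* b)) D.refl a b)

    *-identityʳ : ∀ x → x * 1# ≈ x
    *-identityʳ x = trans (*-comm x 1#) (*-identityˡ x)

    *-distribʳ : ∀ z x y → (x + y) * z ≈ x * z + y * z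
    *-distribʳ (e / f [ _ ]) (a / b [ _ ]) (c / d [ _ ]) = mk≈
      (solve 6 (λ a b c d e f →
        ((a :* d :+ c :* b) :* e) :* ((b :* f) :* (d :* f))
        := ((a :* e) :* (d :* f) :+ (c :* e) :* (b :* f)) :* ((b :* d) :* f))
        D.refl a b c d e f)

    *-distribˡ : ∀ z x y → z * (x + y) ≈ z * x + z * y
    *-distribˡ z x y = trans (*-comm z (x + y))
      (trans (*-distribʳ z x y) (+-cong (*-comm x z) (*-comm y z)))

  commutativeRing : CommutativeRing 0ℓ 0ℓ
  commutativeRing = record
    { Carrier = Fraction
    ; _≈_     = _≈_
    ; _+_     = _+_
    ; _*_     = _*_
    ; -_      = -_
    ; 0#      = 0#
    ; 1#      = 1#
    ; isCommutativeRing = record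
      { isRing = record
        { +-isAbelianGroup = record
          { isGroup = record
            { isMonoid = record
              { isSemigroup = record
                { isMagma = record
                  { isEquivalence = record { refl = refl ; sym = sym ; trans = trans }
                  ; ∙-cong        = +-cong
                  }
                ; assoc = +-assoc
                }
              ; identity = +-identityˡ , +-identityʳ
              }
            ; inverse = -‿inverseˡ , -‿inverseʳ
            ; ⁻¹-cong = -‿cong
            }
          ; comm = +-comm
          }
        ; *-cong     = *-cong
        ; *-assoc    = *-assoc
        ; *-identity = *-identityˡ , *-identityʳ
        ; distrib    = *-distribˡ , *-distribʳ
        }
      ; *-comm = *-comm
      }
    }

  ⁻¹-inverseʳ : ∀ x → ¬ x ≈ 0# → x * x ⁻¹ ≈ 1#
  ⁻¹-inverseʳ (a / b [ b≉0 ]) x≉0 with a D.≟ D.0#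
  ... | no _    = mk≈ (solve 2 (λ a b → (a :* b) :* con 1 := con 1 :* (b :* a)) D.refl a b)
  ... | yes a≈0 = contradiction
    (mk≈ (D.trans (D.*-identityʳ a) (D.trans a≈0 (D.sym (D.zeroˡ b))))) x≉0

  _≟_ : ∀ x y → Dec (x ≈ y)
  x ≟ y = Dec.map′ mk≈ cross ((num x D.* den y) D.≟ (num y D.* den x))

  open Algebra.Properties.Semiring.Exp (CommutativeRing.semiring commutativeRing) public
    using (_^_)
  open Algebra.Properties.Semiring.Mult (CommutativeRing.semiring commutativeRing) public
    using () renaming (_×_ to _times_)

  infixr 8 _^ᶻ_

  _^ᶻ_ : Fraction → ℤ → Fraction
  x ^ᶻ (+ k)    = x ^ k
  x ^ᶻ -[1+ k ] = (x ^ suc k) ⁻¹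

ℚ[_] : ℕ → DiscreteDomain
ℚ[ zero  ] = ℚ-domain
ℚ[ suc m ] = Polynomial.domain ℚ[ m ]

indeterminate : ∀ {m} → Fin m → DiscreteDomain.Carrier ℚ[ m ]
indeterminate {suc m} zero    = Polynomial.variable-t ℚ[ m ]
indeterminate {suc m} (suc i) = Polynomial.constant ℚ[ m ] (indeterminate i)

-- All vectors of k natural numbers with sum n, each listed exactly once.
compositions : ∀ k → ℕ → List (Vec ℕ k)
compositions zero    zero    = [] ∷ []
compositions zero    (suc n) = []
compositions (suc k) n       =
  concatMap (λ j → map (j ∷_) (compositions k (n ℕ.∸ j))) (upTo (suc n))

-- For p = (p₁ , … , p_k): entry p j = p_j if 1 ≤ j ≤ k, and 0 otherwise.
entry : ∀ {k} → Vec ℕ k → ℕ → ℕ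
entry p       zero          = 0
entry []      (suc j)       = 0
entry (x ∷ p) (suc zero)    = x
entry (x ∷ p) (suc (suc j)) = entry p (suc j)

-- In the case a ≥ 1 the division is exact: writing a = a′ + 1, the quotient
-- (a′ + b + c)! / (a′! b! c!) is a multinomial coefficient.
C : ℕ → ℕ → ℕ → ℕ
C zero       zero    zero    = 1
C zero       zero    (suc _) = 0
C zero       (suc _) _       = 0
C a@(suc a′) b       c       = (a ℕ.+ b ℕ.+ c ℕ.∸ 1) ! ℕ./ (a′ ! ℕ.* b ! ℕ.* c !)
  where instance
    _ = m*n≢0 (a′ ! ℕ.* b !) (c !) {{m*n≢0 (a′ !) (b !) {{a′ !≢0}} {{b !≢0}}}} {{c !≢0}}

module QSystem (r : ℕ) where

  -- The field ℚ(R₁₀ , … , R_r0 , R₁₁ , … , R_r1) of rational functions.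
  open FieldOfFractions ℚ[ r ℕ.+ r ] public

  K : Set
  K = Fraction

  init₀ init₁ : Fin r → K
  init₀ i = fromDomain (indeterminate (i ↑ˡ r))
  init₁ i = fromDomain (indeterminate (r ↑ʳ i))

  -- Only the values R α n with α ≤ r + 1 are constrained.
  record IsSolution (R : ℕ → ℤ → K) : Set where
    field
      recursion : ∀ α n → 1 ≤ α → α ≤ r →
        R α (n ℤ.+ 1ℤ) * R α (n ℤ.- 1ℤ) ≈
          R α n ^ 2 + R (α ℕ.+ 1) n * R (α ℕ.∸ 1) n
      boundary₀ : ∀ n → R 0 n ≈ 1#
      boundary₁ : ∀ n → R (r ℕ.+ 1) n ≈ 1#
      -- Fin r counts from 0, whereas α runs over 1 , … , r.
      initial₀  : ∀ (i : Fin r) → R (suc (toℕ i)) 0ℤ ≈ init₀ i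
      initial₁  : ∀ (i : Fin r) → R (suc (toℕ i)) 1ℤ ≈ init₁ i

  fromℕ : ℕ → K
  fromℕ k = k times 1#

  ∑ : ∀ {I : Set} → List I → (I → K) → K
  ∑ is f = foldr _+_ 0# (map f is)

  -- ∏ m f = f 1 * … * f m
  ∏ : ℕ → (ℕ → K) → K
  ∏ zero    f = 1#
  ∏ (suc m) f = ∏ m f * f (suc m)

  infixl 7 _÷_
  _÷_ : K → K → K
  x ÷ y = x * y ⁻¹

{-# OPTIONS --safe #-}

-- Write H_n(t) for the finite continued fraction 1 / (1 − t y₁ − t y₂ / (1 − t y₃ − t y₄ / ⋯)),
-- whose weights y_j are the Laurent monomials in the R_(α,n) and R_(α,n+1) that at n = 0 occur in
-- the formula. The Q-system says exactly that the weights at time n + 1 arise from those at time n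
-- by a qd-type rearrangement, which gives H_n = 1 + t (R_(1,n+2) / R_(1,n+1)) H_(n+1). Hence
-- R_(1,n+1+k) is R_(1,n+1) times the coefficient of tᵏ in H_n. Expanding H_0 level by level with
-- (1 − x − y)^(−a) = ∑ C(a,b,c) xᵇ yᶜ gives the sum over p, and the exponents of R_(i,0) and
-- R_(i,1) appear by telescoping. Division by the R_(α,n) is legitimate since they are positive for
-- the ordering of the rational functions in which a polynomial has the sign of its lowest coefficient.
module Submission where

open import Defs
open import Data.Nat as ℕ using (ℕ; zero; suc; _≤_; _<_; _!)
open import Data.Nat.Combinatorics using (nCk≡n!/k![n-k]!) renaming (_C_ to binomial)
open import Data.Integer as ℤ using (ℤ; +_; 1ℤ; _⊖_)
open import Algebra.Bundles using (CommutativeRing)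
open import Data.Empty using (⊥)
open import Data.Fin using (Fin; zero; suc; toℕ; fromℕ<; _↑ˡ_; _↑ʳ_)
import Data.Fin.Properties as Finₚ
import Data.Integer.Properties as ℤₚ
open import Data.List using (List; []; _∷_; _++_; map; foldr; concatMap; applyUpTo; upTo)
import Data.List.Properties as Listₚ
open import Data.Nat.DivMod using (m*n/n≡m; /-congˡ; /-congʳ)
import Data.Nat.Properties as ℕₚ
open import Data.Nat.Solver using (module +-*-Solver)
open import Data.Product using (_×_; _,_; proj₁; proj₂; ∃)
open import Data.Rational as ℚ using (ℚ)
import Data.Rational.Properties as ℚₚ
open import Data.Sum using (_⊎_; inj₁; inj₂)
open import Data.Vec using (Vec; []; _∷_)
open import Level using (Level; _⊔_)
open import Relation.Binary.PropositionalEquality as ≡ using (_≡_)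
open import Relation.Binary.Structures using (IsEquivalence)
open import Relation.Nullary using (¬_; contradiction)
import Algebra.Properties.CommutativeSemiring.Exp
import Algebra.Properties.Semiring.Mult
import Algebra.Solver.Ring.NaturalCoefficients.Default
import Algebra.Properties.Ring
import Relation.Binary.Reasoning.Setoid

-- Series are never divided. A reciprocal 1 / (1 - z) is known through its equation h = 1 + z h, and
-- solutions of such equations are compared by cancellation (`geometric-unique`). The continued
-- fraction is defined as its own expansion into trinomial sums, so the sum over p is present from
-- the start and it is the equation of the reciprocal that needs proof. For this each level carries
-- all its powers a: the inner fraction occurs to the power c inside the outer sum, and Pascal's
-- rule relates power a + 1 to power a.
--
-- Levels are numbered α = 0, ..., r, with o_α = y_(2α+1) and e_α = y_(2α+2). The passage from H_n
-- to H_(n+1) is proved from the innermost level outwards: if X is the old denominator part of level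
-- α, so that the fraction is 1 / (1 - t X), then X = s_α / (1 - t W), where W is the new
-- denominator part of that level without its odd weight.
--
-- The algebra is done over any commutative ring with inverses supplied as data. In the field the
-- inverse is total with 0⁻¹ = 0, so x x⁻¹ = 1 is available only once x is known to be nonzero.

private
  variable
    c ℓ : Level

-- Coefficients of (1 - x - y)^(-a) in the natural numbers.

-- The coefficient of xⁿ in (1 − x)^(−a).
multichoose : ℕ → ℕ → ℕ
multichoose _       zero    = 1
multichoose zero    (suc n) = 0
multichoose (suc a) (suc n) = multichoose a (suc n) ℕ.+ multichoose (suc a) n

multichoose-one : ∀ n → multichoose 1 n ≡ 1
multichoose-one zero    = ≡.refl
multichoose-one (suc n) = multichoose-one n

-- Pascal's rule with denominators cleared: the multipliers `suc a` and `suc n` of its two terms add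
-- up to the leading factor of the factorial.
multichoose-factorials : ∀ a n → multichoose (suc a) n ℕ.* (a ! ℕ.* n !) ≡ (a ℕ.+ n) !
multichoose-factorials a zero = begin
  1 ℕ.* (a ! ℕ.* 1) ≡⟨ ℕₚ.*-identityˡ _ ⟩
  a ! ℕ.* 1         ≡⟨ ℕₚ.*-identityʳ _ ⟩
  a !               ≡⟨ ≡.cong _! (ℕₚ.+-identityʳ a) ⟨
  (a ℕ.+ 0) !       ∎
  where open ≡.≡-Reasoning
multichoose-factorials zero n@(suc _) = begin
  multichoose 1 n ℕ.* (1 ℕ.* n !) ≡⟨ ≡.cong₂ ℕ._*_ (multichoose-one n) (ℕₚ.*-identityˡ _) ⟩
  1 ℕ.* n !                       ≡⟨ ℕₚ.*-identityˡ _ ⟩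
  n !                             ∎
  where open ≡.≡-Reasoning
multichoose-factorials (suc a) (suc n) = begin
  (x ℕ.+ y) ℕ.* ((suc a ℕ.* a !) ℕ.* (suc n ℕ.* n !))
    ≡⟨ solve 6 (λ x y a a! n n! →
         (x :+ y) :* ((a :* a!) :* (n :* n!))
         := a :* (x :* (a! :* (n :* n!))) :+ n :* (y :* ((a :* a!) :* n!)))
         ≡.refl x y (suc a) (a !) (suc n) (n !) ⟩
  suc a ℕ.* (x ℕ.* (a ! ℕ.* suc n !)) ℕ.+ suc n ℕ.* (y ℕ.* (suc a ! ℕ.* n !))
    ≡⟨ ≡.cong₂ (λ u v → suc a ℕ.* u ℕ.+ suc n ℕ.* v)
         (multichoose-factorials a (suc n))
         (≡.trans (multichoose-factorials (suc a) n) (≡.cong _! (≡.sym (ℕₚ.+-suc a n)))) ⟩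
  suc a ℕ.* (a ℕ.+ suc n) ! ℕ.+ suc n ℕ.* (a ℕ.+ suc n) !
    ≡⟨ ℕₚ.*-distribʳ-+ _ (suc a) (suc n) ⟨
  (suc a ℕ.+ suc n) ! ∎
  where
  open ≡.≡-Reasoning
  open +-*-Solver
  x = multichoose (suc a) (suc n)
  y = multichoose (suc (suc a)) n

-- The coefficient of xᵇ yᶜ in (1 - x - y)^(-a): that of z^(b+c) in (1 - z)^(-a), times the binomial
-- coefficient of xᵇ yᶜ in (x + y)^(b+c). Without division the recurrences follow from
-- distributivity, and a = 0 needs no separate case.
trinomial : ℕ → ℕ → ℕ → ℕ
trinomial a b c = multichoose a (b ℕ.+ c) ℕ.* multichoose (suc b) c

C≡trinomial : ∀ a b c → C a b c ≡ trinomial a b c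
C≡trinomial zero    zero    zero    = ≡.refl
C≡trinomial zero    zero    (suc c) = ≡.refl
C≡trinomial zero    (suc b) c       = ≡.refl
C≡trinomial (suc a) b       c       = begin
  C (suc a) b c                                      ≡⟨ /-congˡ (≡.sym factorials) ⟩
  trinomial (suc a) b c ℕ.* d ℕ./ d                  ≡⟨ m*n/n≡m (trinomial (suc a) b c) d ⟩
  trinomial (suc a) b c                              ∎
  where
  open ≡.≡-Reasoning
  open +-*-Solver
  d = a ! ℕ.* b ! ℕ.* c !
  instance
    _ = ℕₚ.m*n≢0 (a ! ℕ.* b !) (c !)
          {{ℕₚ.m*n≢0 (a !) (b !) {{a ℕₚ.!≢0}} {{b ℕₚ.!≢0}}}} {{c ℕₚ.!≢0}}
  x = multichoose (suc a) (b ℕ.+ c)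
  y = multichoose (suc b) c
  factorials : x ℕ.* y ℕ.* d ≡ (a ℕ.+ b ℕ.+ c) !
  factorials = begin
    x ℕ.* y ℕ.* d
      ≡⟨ solve 5 (λ x y a b c → x :* y :* (a :* b :* c) := x :* (a :* (y :* (b :* c))))
           ≡.refl x y (a !) (b !) (c !) ⟩
    x ℕ.* (a ! ℕ.* (y ℕ.* (b ! ℕ.* c !)))
      ≡⟨ ≡.cong (λ z → x ℕ.* (a ! ℕ.* z)) (multichoose-factorials b c) ⟩
    x ℕ.* (a ! ℕ.* (b ℕ.+ c) !)
      ≡⟨ multichoose-factorials a (b ℕ.+ c) ⟩
    (a ℕ.+ (b ℕ.+ c)) !
      ≡⟨ ≡.cong _! (ℕₚ.+-assoc a b c) ⟨
    (a ℕ.+ b ℕ.+ c) ! ∎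

-- The binomial coefficient of the theorem is the trinomial factor of the outermost level, where the
-- continued fraction is taken to the power 1.
binomial≡C : ∀ b c → binomial (b ℕ.+ c) b ≡ C 1 b c
binomial≡C b c = begin
  binomial (b ℕ.+ c) b
    ≡⟨ nCk≡n!/k![n-k]! (ℕₚ.m≤m+n b c) ⟩
  (b ℕ.+ c) ! ℕ./ (b ! ℕ.* (b ℕ.+ c ℕ.∸ b) !)
    ≡⟨ /-congʳ (≡.cong₂ ℕ._*_ (≡.sym (ℕₚ.*-identityˡ (b !))) (≡.cong _! (ℕₚ.m+n∸m≡n b c))) ⟩
  C 1 b c ∎
  where
  open ≡.≡-Reasoning
  instance
    _ = ℕₚ.m*n≢0 (b !) ((b ℕ.+ c ℕ.∸ b) !) {{b ℕₚ.!≢0}} {{(b ℕ.+ c ℕ.∸ b) ℕₚ.!≢0}}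
    _ = ℕₚ.m*n≢0 (0 ! ℕ.* b !) (c !)
          {{ℕₚ.m*n≢0 (0 !) (b !) {{0 ℕₚ.!≢0}} {{b ℕₚ.!≢0}}}} {{c ℕₚ.!≢0}}

-- This and the next two recurrences compare coefficients in (1 - x - y)^(-a) = (1 - x - y) (1 - x -
-- y)^(-a-1). They are separated by which of b and c vanishes, so that no exponent drops below zero.
trinomial-suc-zero : ∀ a b →
  trinomial (suc a) (suc b) 0 ≡ trinomial a (suc b) 0 ℕ.+ trinomial (suc a) b 0
trinomial-suc-zero a b = ℕₚ.*-distribʳ-+ 1 (multichoose a (suc b ℕ.+ 0)) _

trinomial-zero-suc : ∀ a c →
  trinomial (suc a) 0 (suc c) ≡ trinomial a 0 (suc c) ℕ.+ trinomial (suc a) 0 c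
trinomial-zero-suc a c = ℕₚ.*-distribʳ-+ (multichoose 1 c) (multichoose a (suc c)) _

trinomial-suc-suc : ∀ a b c →
  trinomial (suc a) (suc b) (suc c) ≡
    trinomial a (suc b) (suc c) ℕ.+
      (trinomial (suc a) b (suc c) ℕ.+ trinomial (suc a) (suc b) c)
trinomial-suc-suc a b c = begin
  (x ℕ.+ y) ℕ.* (z ℕ.+ w)
    ≡⟨ solve 4 (λ x y z w → (x :+ y) :* (z :+ w) := x :* (z :+ w) :+ (y :* z :+ y :* w))
         ≡.refl x y z w ⟩
  x ℕ.* (z ℕ.+ w) ℕ.+ (y ℕ.* z ℕ.+ y ℕ.* w)
    ≡⟨ ≡.cong (λ n → x ℕ.* (z ℕ.+ w) ℕ.+ (y ℕ.* z ℕ.+ multichoose (suc a) n ℕ.* w))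
         (ℕₚ.+-suc b c) ⟩
  _ ∎
  where
  open ≡.≡-Reasoning
  open +-*-Solver
  x = multichoose a (suc b ℕ.+ suc c)
  y = multichoose (suc a) (b ℕ.+ suc c)
  z = multichoose (suc b) (suc c)
  w = multichoose (suc (suc b)) c

-- Formal power series over a commutative ring.

module PowerSeries (R : CommutativeRing c ℓ) where
  private
    module R where
      open CommutativeRing R public
      open Algebra.Properties.CommutativeSemiring.Exp commutativeSemiring public
      open Algebra.Properties.Semiring.Mult semiring public using () renaming (_×_ to _times_)
      open Algebra.Properties.Semiring.Mult semiring public using (×-homo-+; ×-congˡ)
    open Algebra.Solver.Ring.NaturalCoefficients.Default R.commutativeSemiring
      using (solve; _:=_; _:+_; _:*_; con)
    module R-Reasoning = Relation.Binary.Reasoning.Setoid R.setoid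
  open R using () renaming (Carrier to A)

  Series : Set c
  Series = ℕ → A

  infix 4 _≈_
  record _≈_ (f g : Series) : Set ℓ where
    constructor mk≈
    field at : ∀ n → f n R.≈ g n
  open _≈_ public

  infixl 6 _+_
  infixl 7 _*_

  _+_ : Series → Series → Series
  (f + g) n = f n R.+ g n

  -_ : Series → Series
  (- f) n = R.- f n

  0# : Series
  0# _ = R.0#

  const : A → Series
  const x zero    = x
  const x (suc _) = R.0#

  1# : Series
  1# = const R.1#

  tail : Series → Series
  tail f n = f (suc n)

  _*_ : Series → Series → Series
  (f * g) zero    = f 0 R.* g 0
  (f * g) (suc n) = f 0 R.* g (suc n) R.+ (tail f * g) n

  t : Series
  t zero    = R.0#
  t (suc n) = 1# n

  isEquivalence : IsEquivalence _≈_
  isEquivalence = record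
    { refl  = mk≈ λ _ → R.refl
    ; sym   = λ e → mk≈ λ n → R.sym (at e n)
    ; trans = λ e f → mk≈ λ n → R.trans (at e n) (at f n)
    }

  *-cong : ∀ {f f′ g g′} → f ≈ f′ → g ≈ g′ → f * g ≈ f′ * g′
  *-cong e h = mk≈ (go e)
    where
    go : ∀ {f f′} → f ≈ f′ → ∀ n → (f * _) n R.≈ (f′ * _) n
    go e zero    = R.*-cong (at e 0) (at h 0)
    go e (suc n) = R.+-cong (R.*-cong (at e 0) (at h (suc n))) (go (mk≈ λ k → at e (suc k)) n)

  zero-* : ∀ g n → (0# * g) n R.≈ R.0#
  zero-* g zero    = R.zeroˡ _
  zero-* g (suc n) = R.trans (R.+-cong (R.zeroˡ _) (zero-* g n)) (R.+-identityˡ _)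

  const-* : ∀ x f n → (const x * f) n R.≈ x R.* f n
  const-* x f zero    = R.refl
  const-* x f (suc n) = R.trans (R.+-congˡ (zero-* f n)) (R.+-identityʳ _)

  -- Mirror image of the defining recursion, peeling the right factor instead of the left; comparing
  -- the two gives commutativity.
  *-suc : ∀ f g n → (f * g) (suc n) R.≈ f (suc n) R.* g 0 R.+ (f * tail g) n
  *-suc f g zero    = R.+-comm _ _
  *-suc f g (suc n) = begin
    f 0 R.* g (2 ℕ.+ n) R.+ (tail f * g) (suc n)
      ≈⟨ R.+-congˡ (*-suc (tail f) g n) ⟩
    f 0 R.* g (2 ℕ.+ n) R.+ (f (2 ℕ.+ n) R.* g 0 R.+ (tail f * tail g) n)
      ≈⟨ solve 3 (λ a b c → a :+ (b :+ c) := b :+ (a :+ c)) R.refl _ _ _ ⟩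
    f (2 ℕ.+ n) R.* g 0 R.+ (f 0 R.* g (2 ℕ.+ n) R.+ (tail f * tail g) n) ∎
    where open R-Reasoning

  *-comm : ∀ f g → f * g ≈ g * f
  *-comm f g = mk≈ (go f)
    where
    go : ∀ f n → (f * g) n R.≈ (g * f) n
    go f zero    = R.*-comm _ _
    go f (suc n) = begin
      f 0 R.* g (suc n) R.+ (tail f * g) n ≈⟨ R.+-cong (R.*-comm _ _) (go (tail f) n) ⟩
      g (suc n) R.* f 0 R.+ (g * tail f) n ≈⟨ *-suc g f n ⟨
      (g * f) (suc n)                      ∎
      where open R-Reasoning

  *-distribʳ : ∀ h f g → (f + g) * h ≈ f * h + g * h
  *-distribʳ h f g = mk≈ (go f g)
    where
    go : ∀ f g n → ((f + g) * h) n R.≈ (f * h + g * h) n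
    go f g zero    = R.distribʳ _ _ _
    go f g (suc n) = begin
      (f 0 R.+ g 0) R.* h (suc n) R.+ (tail (f + g) * h) n
        ≈⟨ R.+-congˡ (go (tail f) (tail g) n) ⟩
      (f 0 R.+ g 0) R.* h (suc n) R.+ ((tail f * h) n R.+ (tail g * h) n)
        ≈⟨ solve 5 (λ a b c d e → (a :+ b) :* c :+ (d :+ e) := a :* c :+ d :+ (b :* c :+ e))
             R.refl (f 0) (g 0) (h (suc n)) ((tail f * h) n) ((tail g * h) n) ⟩
      (f * h + g * h) (suc n) ∎
      where open R-Reasoning

  -- The tail of f g is f 0 times the tail of g plus a product; associativity meets the scaled
  -- summand.
  scale-* : ∀ x f g n → ((λ k → x R.* f k) * g) n R.≈ x R.* (f * g) n
  scale-* x f g zero    = R.*-assoc _ _ _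
  scale-* x f g (suc n) = begin
    x R.* f 0 R.* g (suc n) R.+ ((λ k → x R.* tail f k) * g) n
      ≈⟨ R.+-cong (R.*-assoc _ _ _) (scale-* x (tail f) g n) ⟩
    x R.* (f 0 R.* g (suc n)) R.+ x R.* (tail f * g) n
      ≈⟨ R.distribˡ _ _ _ ⟨
    x R.* (f * g) (suc n) ∎
    where open R-Reasoning

  *-assoc : ∀ f g h → (f * g) * h ≈ f * (g * h)
  *-assoc f g h = mk≈ (go f)
    where
    go : ∀ f n → ((f * g) * h) n R.≈ (f * (g * h)) n
    go f zero    = R.*-assoc _ _ _
    go f (suc n) = begin
      f 0 R.* g 0 R.* h (suc n) R.+ (((λ k → f 0 R.* tail g k) + tail f * g) * h) n
        ≈⟨ R.+-congˡ (at (*-distribʳ h _ (tail f * g)) n) ⟩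
      f 0 R.* g 0 R.* h (suc n) R.+ (((λ k → f 0 R.* tail g k) * h) n R.+ ((tail f * g) * h) n)
        ≈⟨ R.+-congˡ (R.+-cong (scale-* (f 0) (tail g) h n) (go (tail f) n)) ⟩
      f 0 R.* g 0 R.* h (suc n) R.+ (f 0 R.* (tail g * h) n R.+ (tail f * (g * h)) n)
        ≈⟨ solve 5 (λ a b c d e → a :* b :* c :+ (a :* d :+ e) := a :* (b :* c :+ d) :+ e)
             R.refl (f 0) (g 0) (h (suc n)) ((tail g * h) n) ((tail f * (g * h)) n) ⟩
      (f * (g * h)) (suc n) ∎
      where open R-Reasoning

  *-identityˡ : ∀ f → 1# * f ≈ f
  *-identityˡ f = mk≈ λ n → R.trans (const-* R.1# f n) (R.*-identityˡ _)

  commutativeRing : CommutativeRing c ℓ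
  commutativeRing = record
    { Carrier = Series
    ; _≈_     = _≈_
    ; _+_     = _+_
    ; _*_     = _*_
    ; -_      = -_
    ; 0#      = 0#
    ; 1#      = 1#
    ; isCommutativeRing = record
      { isRing = record
        { +-isAbelianGroup = record
          { isGroup = record
            { isMonoid = record
              { isSemigroup = record
                { isMagma = record
                  { isEquivalence = isEquivalence
                  ; ∙-cong        = λ e f → mk≈ λ n → R.+-cong (at e n) (at f n)
                  }
                ; assoc = λ _ _ _ → mk≈ λ _ → R.+-assoc _ _ _
                }
              ; identity = (λ _ → mk≈ λ _ → R.+-identityˡ _) , λ _ → mk≈ λ _ → R.+-identityʳ _
              }
            ; inverse = (λ _ → mk≈ λ _ → R.-‿inverseˡ _) , λ _ → mk≈ λ _ → R.-‿inverseʳ _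
            ; ⁻¹-cong = λ e → mk≈ λ n → R.-‿cong (at e n)
            }
          ; comm = λ _ _ → mk≈ λ _ → R.+-comm _ _
          }
        ; *-cong     = *-cong
        ; *-assoc    = *-assoc
        ; *-identity = *-identityˡ , λ f → trans (*-comm f 1#) (*-identityˡ f)
        ; distrib    = (λ h f g → trans (*-comm h (f + g)) (trans (*-distribʳ h f g)
                         (mk≈ λ n → R.+-cong (at (*-comm f h) n) (at (*-comm g h) n))))
                     , *-distribʳ
        }
      ; *-comm = *-comm
      }
    }
    where open IsEquivalence isEquivalence using (trans)

  private
    module P = CommutativeRing commutativeRing
    open Algebra.Solver.Ring.NaturalCoefficients.Default P.commutativeSemiring
      using () renaming (solve to solveₚ; _:=_ to _⊜_; _:+_ to _⊕_; _:*_ to _⊗_; con to conₚ)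
    module P-Reasoning = Relation.Binary.Reasoning.Setoid P.setoid

  const-cong : ∀ {x y} → x R.≈ y → const x ≈ const y
  const-cong e = mk≈ λ { zero → e ; (suc _) → R.refl }

  const-+ : ∀ x y → const (x R.+ y) ≈ const x + const y
  const-+ x y = mk≈ λ { zero → R.refl ; (suc _) → R.sym (R.+-identityˡ _) }

  const-homo-* : ∀ x y → const (x R.* y) ≈ const x * const y
  const-homo-* x y = mk≈ λ
    { zero    → R.refl
    ; (suc n) → R.sym (R.trans (const-* x (const y) (suc n)) (R.zeroʳ x))
    }

  t-*-zero : ∀ f → (t * f) 0 R.≈ R.0#
  t-*-zero f = R.zeroˡ _

  t-*-suc : ∀ f n → (t * f) (suc n) R.≈ f n
  t-*-suc f n = R.trans (R.+-cong (R.zeroˡ _) (at (*-identityˡ f) n)) (R.+-identityˡ _)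

  -- t-adic sums and the trinomial expansion.

  -- The t-adically convergent sum of tᵇ F b over all b.
  powerSum : (ℕ → Series) → Series
  powerSum F zero    = F 0 0
  powerSum F (suc n) = F 0 (suc n) R.+ powerSum (λ b → F (suc b)) n

  powerSum-cong : ∀ {F G} → (∀ b → F b ≈ G b) → powerSum F ≈ powerSum G
  powerSum-cong e = mk≈ (go e)
    where
    go : ∀ {F G} → (∀ b → F b ≈ G b) → ∀ n → powerSum F n R.≈ powerSum G n
    go e zero    = at (e 0) 0
    go e (suc n) = R.+-cong (at (e 0) (suc n)) (go (λ b → e (suc b)) n)

  powerSum-+ : ∀ F G → powerSum (λ b → F b + G b) ≈ powerSum F + powerSum G
  powerSum-+ F G = mk≈ (go F G)
    where
    go : ∀ F G n → powerSum (λ b → F b + G b) n R.≈ (powerSum F + powerSum G) n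
    go F G zero    = R.refl
    go F G (suc n) = R.trans (R.+-congˡ (go _ _ n))
      (solve 4 (λ a b c d → a :+ b :+ (c :+ d) := a :+ c :+ (b :+ d)) R.refl _ _ _ _)

  powerSum-zero : ∀ {F} → (∀ b → F b ≈ 0#) → powerSum F ≈ 0#
  powerSum-zero e = mk≈ (go e)
    where
    go : ∀ {F} → (∀ b → F b ≈ 0#) → ∀ n → powerSum F n R.≈ R.0#
    go e zero    = at (e 0) 0
    go e (suc n) = R.trans (R.+-cong (at (e 0) (suc n)) (go (λ b → e (suc b)) n))
                           (R.+-identityˡ _)

  powerSum-step : ∀ F → powerSum F ≈ F 0 + t * powerSum (λ b → F (suc b))
  powerSum-step F = mk≈ λ
    { zero    → R.sym (R.trans (R.+-congˡ (t-*-zero (powerSum λ b → F (suc b)))) (R.+-identityʳ _))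
    ; (suc n) → R.+-congˡ (R.sym (t-*-suc (powerSum λ b → F (suc b)) n))
    }

  powerSum-head : ∀ {F} → (∀ b → F (suc b) ≈ 0#) → powerSum F ≈ F 0
  powerSum-head {F} e = begin
    powerSum F                              ≈⟨ powerSum-step F ⟩
    F 0 + t * powerSum (λ b → F (suc b))    ≈⟨ P.+-congˡ (P.*-congˡ (powerSum-zero e)) ⟩
    F 0 + t * 0#                            ≈⟨ P.+-congˡ (P.zeroʳ t) ⟩
    F 0 + 0#                                ≈⟨ P.+-identityʳ _ ⟩
    F 0                                     ∎
    where open P-Reasoning

  powerSum-*ˡ : ∀ g F → powerSum (λ b → g * F b) ≈ g * powerSum F
  powerSum-*ˡ g F = mk≈ (go F)
    where
    split : ∀ F → g * powerSum F ≈ g * F 0 + t * (g * powerSum (λ b → F (suc b)))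
    split F = P.trans (P.*-congˡ (powerSum-step F))
      (solveₚ 4 (λ g a t s → g ⊗ (a ⊕ t ⊗ s)
        ⊜ g ⊗ a ⊕ t ⊗ (g ⊗ s))
        P.refl g (F 0) t (powerSum λ b → F (suc b)))
    go : ∀ F n → powerSum (λ b → g * F b) n R.≈ (g * powerSum F) n
    go F zero    = R.sym (R.trans (at (split F) 0)
      (R.trans (R.+-congˡ (t-*-zero (g * powerSum (λ b → F (suc b))))) (R.+-identityʳ _)))
    go F (suc n) = R.sym (R.trans (at (split F) (suc n)) (R.+-congˡ
      (R.trans (t-*-suc (g * powerSum (λ b → F (suc b))) n) (R.sym (go (λ b → F (suc b)) n)))))

  -- Lowering the index by one is multiplication by t under `powerSum`. The zero at index 0 merges
  -- the three recurrences of `trinomial` into one formula for all b and c.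
  delay : (ℕ → Series) → ℕ → Series
  delay F zero    = 0#
  delay F (suc b) = F b

  powerSum-delay : ∀ F → powerSum (delay F) ≈ t * powerSum F
  powerSum-delay F = P.trans (powerSum-step (delay F)) (P.+-identityˡ _)

  private
    fromℕ : ℕ → A
    fromℕ n = n R.times R.1#

  trinomialWeight : A → A → ℕ → ℕ → ℕ → A
  trinomialWeight x y a b c = x R.^ b R.* (y R.^ c R.* fromℕ (trinomial a b c))

  -- The binomial expansion of (1 − t (x + y T 1))^(−a), where T c plays the role of (T 1)^c.
  trinomialSeries : A → A → (ℕ → Series) → ℕ → Series
  trinomialSeries x y T a =
    powerSum λ b → powerSum λ c → const (trinomialWeight x y a b c) * T c

  module _ (x y : A) where
    private
      w = trinomialWeight x y

    weight-vanishes : ∀ b c → trinomial 0 b c ≡ 0 → w 0 b c R.≈ R.0#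
    weight-vanishes b c e = begin
      x R.^ b R.* (y R.^ c R.* fromℕ (trinomial 0 b c)) ≈⟨ R.*-congˡ (R.*-congˡ (R.×-congˡ e)) ⟩
      x R.^ b R.* (y R.^ c R.* R.0#)                    ≈⟨ R.*-congˡ (R.zeroʳ _) ⟩
      x R.^ b R.* R.0#                                  ≈⟨ R.zeroʳ _ ⟩
      R.0#                                              ∎
      where open R-Reasoning

    weight-0-0 : ∀ a → w a 0 0 R.≈ R.1#
    weight-0-0 a = solve 0 (con 1 :* (con 1 :* (con 1 :+ con 0)) := con 1) R.refl

    weight-suc-0 : ∀ a b → w (suc a) (suc b) 0 R.≈ w a (suc b) 0 R.+ x R.* w (suc a) b 0
    weight-suc-0 a b = begin
      _ ≈⟨ R.*-congˡ (R.*-congˡ (R.trans (R.×-congˡ (trinomial-suc-zero a b))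
          (R.×-homo-+ R.1# (trinomial a (suc b) 0) _))) ⟩
      _ ≈⟨ solve 5 (λ x p q m n → (x :* p) :* (q :* (m :+ n)) :=
          (x :* p) :* (q :* m) :+ x :* (p :* (q :* n)))
             R.refl x (x R.^ b) R.1# (fromℕ (trinomial a (suc b) 0))
                 (fromℕ (trinomial (suc a) b 0)) ⟩
      _ ∎
      where open R-Reasoning

    weight-0-suc : ∀ a c → w (suc a) 0 (suc c) R.≈ w a 0 (suc c) R.+ y R.* w (suc a) 0 c
    weight-0-suc a c = begin
      _ ≈⟨ R.*-congˡ (R.*-congˡ (R.trans (R.×-congˡ (trinomial-zero-suc a c))
          (R.×-homo-+ R.1# (trinomial a 0 (suc c)) _))) ⟩
      _ ≈⟨ solve 5 (λ y p q m n → q :* ((y :* p) :* (m :+ n)) :=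
          q :* ((y :* p) :* m) :+ y :* (q :* (p :* n)))
             R.refl y (y R.^ c) R.1# (fromℕ (trinomial a 0 (suc c)))
                 (fromℕ (trinomial (suc a) 0 c)) ⟩
      _ ∎
      where open R-Reasoning

    weight-suc-suc : ∀ a b c → w (suc a) (suc b) (suc c) R.≈
      w a (suc b) (suc c) R.+ (x R.* w (suc a) b (suc c) R.+ y R.* w (suc a) (suc b) c)
    weight-suc-suc a b c = begin
      _ ≈⟨ R.*-congˡ (R.*-congˡ (R.trans (R.×-congˡ (trinomial-suc-suc a b c))
             (R.trans (R.×-homo-+ R.1# (trinomial a (suc b) (suc c)) _)
               (R.+-congˡ (R.×-homo-+ R.1# (trinomial (suc a) b (suc c)) _))))) ⟩
      _ ≈⟨ solve 7 (λ x y p q k m n → (x :* p) :* ((y :* q) :* (k :+ (m :+ n)))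
             := (x :* p) :* ((y :* q) :* k) :+
                 (x :* (p :* ((y :* q) :* m)) :+ y :* ((x :* p) :* (q :* n))))
             R.refl x y (x R.^ b) (y R.^ c) (fromℕ (trinomial a (suc b) (suc c)))
             (fromℕ (trinomial (suc a) b (suc c))) (fromℕ (trinomial (suc a) (suc b) c)) ⟩
      _ ∎
      where open R-Reasoning

    module _ (T : ℕ → Series) (T-zero : T 0 ≈ 1#) (T-suc : ∀ c → T (suc c) ≈ T 1 * T c) where
      private
        term : ℕ → ℕ → ℕ → Series
        term a b c = const (w a b c) * T c
        row : ℕ → ℕ → Series
        row a b = powerSum (term a b)

      trinomialSeries-zero : trinomialSeries x y T 0 ≈ 1#
      trinomialSeries-zero = begin
        powerSum (row 0)   ≈⟨ powerSum-head (λ b →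
            powerSum-zero (λ c → vanish (weight-vanishes (suc b) c ≡.refl))) ⟩
        row 0 0            ≈⟨ powerSum-head (λ c → vanish (weight-vanishes 0 (suc c) ≡.refl)) ⟩
        term 0 0 0         ≈⟨ P.*-cong (const-cong (weight-0-0 0)) T-zero ⟩
        1# * 1#            ≈⟨ P.*-identityˡ 1# ⟩
        1#                 ∎
        where
        open P-Reasoning
        vanish : ∀ {v f} → v R.≈ R.0# → const v * f ≈ 0#
        vanish {v} {f} e = mk≈ λ n → R.trans (const-* v f n) (R.trans (R.*-congʳ e) (R.zeroˡ _))

      private
        term-suc : ∀ a b c → term (suc a) b c ≈ term a b c +
          (delay (λ b → const x * term (suc a) b c) b +
           delay (λ c → const y * T 1 * term (suc a) b c) c)
        term-suc a zero zero = begin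
          const (w (suc a) 0 0) * T 0
            ≈⟨ P.*-congʳ (const-cong (R.trans (weight-0-0 (suc a)) (R.sym (weight-0-0 a)))) ⟩
          term a 0 0
            ≈⟨ solveₚ 1 (λ z → z ⊜ z ⊕ (conₚ 0 ⊕ conₚ 0)) P.refl (term a 0 0) ⟩
          term a 0 0 + (0# + 0#) ∎
          where open P-Reasoning
        term-suc a (suc b) zero = begin
          const (w (suc a) (suc b) 0) * T 0
            ≈⟨ P.*-congʳ (P.trans (const-cong (weight-suc-0 a b))
                (P.trans (const-+ _ _) (P.+-congˡ (const-homo-* _ _)))) ⟩
          (const (w a (suc b) 0) + const x * const (w (suc a) b 0)) * T 0
            ≈⟨ solveₚ 4 (λ u x v s → (u ⊕ x ⊗ v) ⊗ s
                 ⊜ u ⊗ s ⊕ (x ⊗ (v ⊗ s) ⊕ conₚ 0))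
                 P.refl (const (w a (suc b) 0)) (const x) (const (w (suc a) b 0)) (T 0) ⟩
          term a (suc b) 0 + (const x * term (suc a) b 0 + 0#) ∎
          where open P-Reasoning
        term-suc a zero (suc c) = begin
          const (w (suc a) 0 (suc c)) * T (suc c)
            ≈⟨ P.*-congʳ (P.trans (const-cong (weight-0-suc a c))
                (P.trans (const-+ _ _) (P.+-congˡ (const-homo-* _ _)))) ⟩
          (const (w a 0 (suc c)) + const y * const (w (suc a) 0 c)) * T (suc c)
            ≈⟨ solveₚ 4 (λ u y v s → (u ⊕ y ⊗ v) ⊗ s
                 ⊜ u ⊗ s ⊕ (conₚ 0 ⊕ y ⊗ v ⊗ s))
                 P.refl (const (w a 0 (suc c))) (const y) (const (w (suc a) 0 c)) (T (suc c)) ⟩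
          term a 0 (suc c) + (0# + const y * const (w (suc a) 0 c) * T (suc c))
            ≈⟨ P.+-congˡ (P.+-congˡ (P.*-congˡ (T-suc c))) ⟩
          term a 0 (suc c) + (0# + const y * const (w (suc a) 0 c) * (T 1 * T c))
            ≈⟨ P.+-congˡ (P.+-congˡ (solveₚ 4 (λ y v s u → y ⊗ v ⊗ (s ⊗ u)
                 ⊜ y ⊗ s ⊗ (v ⊗ u)) P.refl (const y) (const (w (suc a) 0 c)) (T 1) (T c))) ⟩
          term a 0 (suc c) + (0# + const y * T 1 * term (suc a) 0 c) ∎
          where open P-Reasoning
        term-suc a (suc b) (suc c) = begin
          const (w (suc a) (suc b) (suc c)) * T (suc c)
            ≈⟨ P.*-congʳ (P.trans (const-cong (weight-suc-suc a b c))
                (P.trans (const-+ _ _) (P.+-congˡ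
                 (P.trans (const-+ _ _) (P.+-cong (const-homo-* _ _) (const-homo-* _ _)))))) ⟩
          (const u + (const x * const v + const y * const z)) * T (suc c)
            ≈⟨ solveₚ 6 (λ u x v y z s → (u ⊕ (x ⊗ v ⊕ y ⊗ z)) ⊗ s
                 ⊜ u ⊗ s ⊕ (x ⊗ (v ⊗ s) ⊕ y ⊗ z ⊗ s))
                 P.refl (const u) (const x) (const v) (const y) (const z) (T (suc c)) ⟩
          term a (suc b) (suc c) + (const x * term (suc a) b (suc c) +
              const y * const z * T (suc c))
            ≈⟨ P.+-congˡ (P.+-congˡ (P.*-congˡ (T-suc c))) ⟩
          term a (suc b) (suc c) + (const x * term (suc a) b (suc c) +
              const y * const z * (T 1 * T c))
            ≈⟨ P.+-congˡ (P.+-congˡ (solveₚ 4 (λ y v s u → y ⊗ v ⊗ (s ⊗ u)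
                 ⊜ y ⊗ s ⊗ (v ⊗ u)) P.refl (const y) (const z) (T 1) (T c))) ⟩
          term a (suc b) (suc c) + (const x * term (suc a) b (suc c) +
              const y * T 1 * term (suc a) (suc b) c) ∎
          where
          open P-Reasoning
          u = w a (suc b) (suc c)
          v = w (suc a) b (suc c)
          z = w (suc a) (suc b) c

        powerSum-row-delay : ∀ a b → powerSum (λ c → delay (λ b → const x * term a b c) b) ≈
          delay (λ b → const x * row a b) b
        powerSum-row-delay a zero    = powerSum-zero (λ _ → P.refl)
        powerSum-row-delay a (suc b) = powerSum-*ˡ (const x) (term a b)

        row-suc : ∀ a b → row (suc a) b ≈ row a b +
          (delay (λ b → const x * row (suc a) b) b + t * (const y * T 1) * row (suc a) b)
        row-suc a b = begin
          row (suc a) b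
            ≈⟨ powerSum-cong (term-suc a b) ⟩
          powerSum (λ c → term a b c + (D c + E c))
            ≈⟨ P.trans (powerSum-+ (term a b) (λ c → D c + E c)) (P.+-congˡ (powerSum-+ D E)) ⟩
          row a b + (powerSum D + powerSum E)
            ≈⟨ P.+-congˡ (P.+-cong (powerSum-row-delay (suc a) b)
                 (P.trans (powerSum-delay (λ c → const y * T 1 * term (suc a) b c))
                     (P.trans (P.*-congˡ (powerSum-*ˡ _ (term (suc a) b)))
                   (P.sym (P.*-assoc t (const y * T 1) (row (suc a) b)))))) ⟩
          _ ∎
          where
          open P-Reasoning
          D E : ℕ → Series
          D c = delay (λ b → const x * term (suc a) b c) b
          E c = delay (λ c → const y * T 1 * term (suc a) b c) c

      -- Pascal's rule summed over b and c, each lowered index giving a factor t. It says (1 - t (x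
      -- + y T 1)) S (a + 1) = S a, which together with S 0 = 1 pins down the powers of the
      -- reciprocal.
      trinomialSeries-suc : ∀ a → trinomialSeries x y T (suc a) ≈
        trinomialSeries x y T a + t * ((const x + const y * T 1) * trinomialSeries x y T (suc a))
      trinomialSeries-suc a = begin
        S (suc a)
          ≈⟨ powerSum-cong (row-suc a) ⟩
        powerSum (λ b → row a b + (D b + E b))
          ≈⟨ P.trans (powerSum-+ (row a) (λ b → D b + E b)) (P.+-congˡ (powerSum-+ D E)) ⟩
        S a + (powerSum D + powerSum E)
          ≈⟨ P.+-congˡ (P.+-cong (P.trans (powerSum-delay (λ b → const x * row (suc a) b))
              (P.*-congˡ (powerSum-*ˡ (const x) (row (suc a)))))
               (powerSum-*ˡ (t * (const y * T 1)) (row (suc a)))) ⟩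
        S a + (t * (const x * S (suc a)) + t * (const y * T 1) * S (suc a))
          ≈⟨ solveₚ 5 (λ s t x y z → s ⊕ (t ⊗ (x ⊗ z) ⊕ t ⊗ y ⊗ z)
               ⊜ s ⊕ t ⊗ ((x ⊕ y) ⊗ z))
               P.refl (S a) t (const x) (const y * T 1) (S (suc a)) ⟩
        _ ∎
        where
        open P-Reasoning
        S = trinomialSeries x y T
        D E : ℕ → Series
        D b = delay (λ b → const x * row (suc a) b) b
        E b = t * (const y * T 1) * row (suc a) b

-- Reciprocals through their fixed-point equations, and one level of the evolution.

module GeometricSeries (R : CommutativeRing c ℓ) where
  open CommutativeRing R
  open Algebra.Properties.Ring ring using (+-cancelʳ)
  open Algebra.Solver.Ring.NaturalCoefficients.Default commutativeSemiring
    using (solve; _:=_; _:+_; _:*_; con)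
  open Relation.Binary.Reasoning.Setoid setoid

  -- Expanding h b by the first equation gives b + z h b, by the second h a + z h b. Cancelling z h
  -- b replaces an inverse of 1 - z and any convergence argument.
  geometric-unique : ∀ {z h a b} → h ≈ 1# + z * h → b ≈ a + z * b → b ≈ h * a
  geometric-unique {z} {h} {a} {b} h-eq b-eq = +-cancelʳ (z * h * b) b (h * a) (begin
    b + z * h * b         ≈⟨ solve 3 (λ z h b → b :+ z :* h :* b := (con 1 :+ z :* h) :* b) refl z h
        b ⟩
    (1# + z * h) * b      ≈⟨ *-congʳ h-eq ⟨
    h * b                 ≈⟨ *-congˡ b-eq ⟩
    h * (a + z * b)       ≈⟨ solve 4 (λ z h a b → h :* (a :+ z :* b) := h :* a :+ z :* h :* b) refl
        z h a b ⟩
    h * a + z * h * b     ∎)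

  -- Read U = 1 / (1 - t W), H = 1 / (1 - t X) and H′ = 1 / (1 - t (x′ + W)): H is a continued
  -- fraction at the old time, H′ the one of the same level at the new time.
  module _ {t s₂ W X U H x′ H′ : Carrier}
           (X-eq : X ≈ s₂ * U) (U-eq : U ≈ 1# + t * (W * U))
           (H-eq : H ≈ 1# + t * (X * H)) (H′-eq : H′ ≈ 1# + t * ((x′ + W) * H′)) where

    private
      K = H * U

      H-K : H ≈ 1# + t * (s₂ * K)
      H-K = begin
        H                       ≈⟨ H-eq ⟩
        1# + t * (X * H)        ≈⟨ +-congˡ (*-congˡ (*-congʳ X-eq)) ⟩
        1# + t * (s₂ * U * H)   ≈⟨ +-congˡ (*-congˡ
            (solve 3 (λ s u h → s :* u :* h := s :* (h :* u)) refl s₂ U H)) ⟩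
        1# + t * (s₂ * K)       ∎

      -- Since 1 / K = 1 / U - t s₂ = 1 - t (s₂ + W), the product K is H′ with s₂ in place of x′.
      K-eq : K ≈ 1# + t * ((s₂ + W) * K)
      K-eq = begin
        H * U                                    ≈⟨ *-congˡ U-eq ⟩
        H * (1# + t * (W * U))                   ≈⟨
            solve 4 (λ h t w u → h :* (con 1 :+ t :* (w :* u)) := h :+ t :* (w :* (h :* u))) refl H
                t W U ⟩
        H + t * (W * K)                          ≈⟨ +-congʳ H-K ⟩
        1# + t * (s₂ * K) + t * (W * K)          ≈⟨
            solve 4 (λ t s w k → con 1 :+ t :* (s :* k) :+ t :* (w :* k) :=
                con 1 :+ t :* ((s :+ w) :* k)) refl t s₂ W K ⟩
        1# + t * ((s₂ + W) * K)                  ∎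

    evolution-top : x′ ≈ s₂ → H ≈ 1# + t * (x′ * H′)
    evolution-top x′≈s₂ = begin
      H                  ≈⟨ H-K ⟩
      1# + t * (s₂ * K)  ≈⟨ +-congˡ (*-congˡ (*-cong (sym x′≈s₂) K≈H′)) ⟩
      1# + t * (x′ * H′) ∎
      where
      K≈H′ : K ≈ H′
      K≈H′ = trans (geometric-unique
        (trans H′-eq (+-congˡ (sym (*-assoc _ _ _))))
        (trans K-eq (+-congˡ (trans (*-congˡ (*-congʳ (+-congʳ (sym x′≈s₂))))
            (sym (*-assoc _ _ _))))))
        (*-identityʳ H′)

    -- Carries the factorisation one level outwards: x + y H is the old denominator part there, and
    -- y′ H′ is the new one without its odd weight. The pair of conclusions is again of the form
    -- `X-eq`, `U-eq`, with `i * (x + y * H)` as the new U.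
    evolution-step : ∀ {x y y′ i s₁} → s₁ ≈ x + y → s₁ * i ≈ 1# →
      y′ * s₁ ≈ y * s₂ → x′ * s₁ ≈ x * s₂ →
      x + y * H ≈ s₁ * (i * (x + y * H)) ×
      i * (x + y * H) ≈ 1# + t * (y′ * H′ * (i * (x + y * H)))
    evolution-step {x} {y} {y′} {i} {s₁} s₁-eq inv y′-eq x′-eq =
      (begin
        Y             ≈⟨ *-identityˡ Y ⟨
        1# * Y        ≈⟨ *-congʳ inv ⟨
        s₁ * i * Y    ≈⟨ *-assoc s₁ i Y ⟩
        s₁ * (i * Y)  ∎) ,
      (begin
        i * Y                                  ≈⟨ *-congˡ Y-eq ⟩
        i * (s₁ + t * (y′ * H′ * Y))           ≈⟨
            solve 5 (λ i s t p y → i :* (s :+ t :* (p :* y)) := s :* i :+ t :* (p :* (i :* y))) refl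
                i s₁ t (y′ * H′) Y ⟩
        s₁ * i + t * (y′ * H′ * (i * Y))       ≈⟨ +-congʳ inv ⟩
        1# + t * (y′ * H′ * (i * Y))           ∎)
      where
      Y = x + y * H

      -- In s₁ s₂ K = x s₂ K + y s₂ K the first term is x′ s₁ K, which completes the equation of H′
      -- for s₁ K; the second stays as inhomogeneous term.
      s₁K : s₁ * K ≈ H′ * (s₁ + t * (s₂ * (y * K)))
      s₁K = geometric-unique (trans H′-eq (+-congˡ (sym (*-assoc _ _ _)))) (begin
        s₁ * K
          ≈⟨ *-congˡ K-eq ⟩
        s₁ * (1# + t * ((s₂ + W) * K))
          ≈⟨ solve 5 (λ s₁ s₂ t w k → s₁ :* (con 1 :+ t :* ((s₂ :+ w) :* k))
               := s₁ :+ s₁ :* (t :* (s₂ :* k)) :+ t :* (w :* (s₁ :* k))) refl s₁ s₂ t W K ⟩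
        s₁ + s₁ * (t * (s₂ * K)) + t * (W * (s₁ * K))
          ≈⟨ +-congʳ (+-congˡ (*-congʳ s₁-eq)) ⟩
        s₁ + (x + y) * (t * (s₂ * K)) + t * (W * (s₁ * K))
          ≈⟨ solve 7 (λ s₁ s₂ t w k x y → s₁ :+ (x :+ y) :* (t :* (s₂ :* k)) :+
              t :* (w :* (s₁ :* k))
               := s₁ :+ t :* (s₂ :* (y :* k)) :+ (t :* (x :* s₂) :* k :+ t :* w :* (s₁ :* k)))
               refl s₁ s₂ t W K x y ⟩
        s₁ + t * (s₂ * (y * K)) + (t * (x * s₂) * K + t * W * (s₁ * K))
          ≈⟨ +-congˡ (+-congʳ (*-congʳ (*-congˡ x′-eq))) ⟨
        s₁ + t * (s₂ * (y * K)) + (t * (x′ * s₁) * K + t * W * (s₁ * K))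
          ≈⟨ solve 7 (λ s₁ a t w k x′ _ → s₁ :+ a :+ (t :* (x′ :* s₁) :* k :+ t :* w :* (s₁ :* k))
               := s₁ :+ a :+ t :* (x′ :+ w) :* (s₁ :* k)) refl s₁ (t * (s₂ * (y * K))) t W K x′ y ⟩
        s₁ + t * (s₂ * (y * K)) + t * (x′ + W) * (s₁ * K) ∎)

      s₁H : s₁ * H ≈ s₁ + t * (s₂ * (H′ * Y))
      s₁H = begin
        s₁ * H
          ≈⟨ *-congˡ H-K ⟩
        s₁ * (1# + t * (s₂ * K))
          ≈⟨ solve 4 (λ s₁ s₂ t k → s₁ :* (con 1 :+ t :* (s₂ :* k)) := s₁ :+ t :* (s₂ :* (s₁ :* k)))
              refl s₁ s₂ t K ⟩
        s₁ + t * (s₂ * (s₁ * K))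
          ≈⟨ +-congˡ (*-congˡ (*-congˡ (trans s₁K (*-congˡ (+-congʳ s₁-eq))))) ⟩
        s₁ + t * (s₂ * (H′ * (x + y + t * (s₂ * (y * K)))))
          ≈⟨ +-congˡ (*-congˡ (*-congˡ (*-congˡ (solve 5 (λ x y t s k →
               x :+ y :+ t :* (s :* (y :* k)) := x :+ y :* (con 1 :+ t :* (s :* k))) refl x y t s₂
                   K)))) ⟩
        s₁ + t * (s₂ * (H′ * (x + y * (1# + t * (s₂ * K)))))
          ≈⟨ +-congˡ (*-congˡ (*-congˡ (*-congˡ (+-congˡ (*-congˡ H-K))))) ⟨
        s₁ + t * (s₂ * (H′ * Y)) ∎

      -- y H is rewritten as (y / s₁) (s₁ H), after which y s₂ / s₁ = y′ produces the new even
      -- weight.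
      Y-eq : Y ≈ s₁ + t * (y′ * H′ * Y)
      Y-eq = begin
        x + y * H
          ≈⟨ +-congˡ (trans (*-congˡ inv) (*-identityʳ _)) ⟨
        x + y * H * (s₁ * i)
          ≈⟨ solve 5 (λ x y h s i → x :+ y :* h :* (s :* i) := x :+ i :* y :* (s :* h)) refl x y H
              s₁ i ⟩
        x + i * y * (s₁ * H)
          ≈⟨ +-congˡ (*-congˡ s₁H) ⟩
        x + i * y * (s₁ + t * (s₂ * (H′ * Y)))
          ≈⟨ solve 8 (λ x y i s₁ t s₂ h z → x :+ i :* y :* (s₁ :+ t :* (s₂ :* (h :* z)))
               := x :+ y :* (s₁ :* i) :+ i :* (y :* s₂) :* (t :* (h :* z))) refl x y i s₁ t s₂ H′
                   Y ⟩
        x + y * (s₁ * i) + i * (y * s₂) * (t * (H′ * Y))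
          ≈⟨ +-cong (+-congˡ (trans (*-congˡ inv) (*-identityʳ _)))
              (*-congʳ (*-congˡ (sym y′-eq))) ⟩
        x + y + i * (y′ * s₁) * (t * (H′ * Y))
          ≈⟨ +-cong (sym s₁-eq) (solve 6 (λ i y′ s₁ t h z → i :* (y′ :* s₁) :* (t :* (h :* z))
               := s₁ :* i :* (t :* (y′ :* h :* z))) refl i y′ s₁ t H′ Y) ⟩
        s₁ + s₁ * i * (t * (y′ * H′ * Y))
          ≈⟨ +-congˡ (trans (*-congʳ inv) (*-identityˡ _)) ⟩
        s₁ + t * (y′ * H′ * Y) ∎

-- Finite continued fractions and their time evolution.

module ContinuedFraction (R : CommutativeRing c ℓ) where
  private module R = CommutativeRing R
  open R using () renaming (Carrier to A)
  open PowerSeries R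
  private module P where
    open CommutativeRing commutativeRing public
    open GeometricSeries commutativeRing public

  module _ (o e : ℕ → A) where

    -- The a-th power of 1 / (1 − t o_α − t e_α / (1 − t o_(α+1) − ⋯ / (1 − t o_(α+m)))).
    continuedFraction : ℕ → ℕ → ℕ → Series
    continuedFraction zero    α = trinomialSeries (o α) R.0# (λ _ → 1#)
    continuedFraction (suc m) α = trinomialSeries (o α) (e α) (continuedFraction m (suc α))

    -- The X for which the continued fraction is 1 / (1 - t X). At the last level a vanishing term
    -- is kept to match the shape in `trinomialSeries-suc`.
    reciprocalPart : ℕ → ℕ → Series
    reciprocalPart zero    α = const (o α) + const R.0# * 1#
    reciprocalPart (suc m) α = const (o α) + const (e α) * continuedFraction m (suc α) 1

    -- Four statements in one recursion on the depth m: the power law one level deeper is what lets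
    -- the inner family serve as the powers `T c` of the outer one.
    continuedFraction-zero : ∀ m α → continuedFraction m α 0 ≈ 1#
    continuedFraction-suc : ∀ m α a → continuedFraction m α (suc a) ≈
      continuedFraction m α a + t * (reciprocalPart m α * continuedFraction m α (suc a))
    continuedFraction-one : ∀ m α → continuedFraction m α 1 ≈
      1# + t * (reciprocalPart m α * continuedFraction m α 1)
    continuedFraction-power : ∀ m α a → continuedFraction m α (suc a) ≈
      continuedFraction m α 1 * continuedFraction m α a

    continuedFraction-zero zero    α = trinomialSeries-zero _ _ _ P.refl
        (λ _ → P.sym (*-identityˡ 1#))
    continuedFraction-zero (suc m) α = trinomialSeries-zero _ _ _
      (continuedFraction-zero m (suc α)) (continuedFraction-power m (suc α))

    continuedFraction-suc zero    α = trinomialSeries-suc _ _ _ P.refl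
        (λ _ → P.sym (*-identityˡ 1#))
    continuedFraction-suc (suc m) α = trinomialSeries-suc _ _ _
      (continuedFraction-zero m (suc α)) (continuedFraction-power m (suc α))

    continuedFraction-one m α =
      P.trans (continuedFraction-suc m α 0) (P.+-congʳ (continuedFraction-zero m α))

    continuedFraction-power m α a = P.geometric-unique {t * reciprocalPart m α}
      (P.trans (continuedFraction-one m α) (P.+-congˡ (P.sym (*-assoc _ _ _))))
      (P.trans (continuedFraction-suc m α a) (P.+-congˡ (P.sym (*-assoc _ _ _))))

  -- The discrete time evolution of the coefficients is a form of the qd algorithm.
  module Evolution (r : ℕ) (o e o′ e′ s i : ℕ → A)
    (s-split : ∀ α → α < r → s α R.≈ o α R.+ e α) (s-last : s r R.≈ o r)
    (s-inv : ∀ α → α < r → s α R.* i α R.≈ R.1#)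
    (e′-eq : ∀ α → α < r → e′ α R.* s α R.≈ e α R.* s (suc α))
    (o′-eq : ∀ α → α < r → o′ (suc α) R.* s α R.≈ o α R.* s (suc α))
    (o′-zero : o′ 0 R.≈ s 0) where

    -- Level α at two times: the old denominator part is s α / (1 - t W), and W is what the new one
    -- contains beyond o′ α.
    record Factorisation (m α : ℕ) : Set (c ⊔ ℓ) where
      field
        W U  : Series
        X-eq : reciprocalPart o e m α ≈ const (s α) * U
        U-eq : U ≈ 1# + t * (W * U)
        W-eq : reciprocalPart o′ e′ m α ≈ const (o′ α) + W

      H′-eq : continuedFraction o′ e′ m α 1 ≈
        1# + t * ((const (o′ α) + W) * continuedFraction o′ e′ m α 1)
      H′-eq = P.trans (continuedFraction-one o′ e′ m α) (P.+-congˡ (P.*-congˡ (P.*-congʳ W-eq)))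

    const-relation : ∀ {x y z w} → x R.* y R.≈ z R.* w → const x * const y ≈ const z * const w
    const-relation e = P.trans (P.sym (const-homo-* _ _))
        (P.trans (const-cong e) (const-homo-* _ _))

    factorisation : ∀ m α → α ℕ.+ m ≡ r → Factorisation m α
    -- At the last level the denominator part is the constant o r = s r, so W vanishes and U is 1.
    factorisation zero α α≡r with ≡.refl ← ≡.trans (≡.sym α≡r) (ℕₚ.+-identityʳ α) = record
      { W    = const R.0# * 1#
      ; U    = 1#
      ; X-eq = P.trans (P.+-cong (const-cong (R.sym s-last)) 0*1)
          (P.trans (P.+-identityʳ _) (P.sym (P.*-identityʳ _)))
      ; U-eq = P.sym (P.trans (P.+-congˡ (P.trans (P.*-congˡ (P.trans (P.*-congʳ 0*1) (P.zeroˡ _)))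
          (P.zeroʳ t)))
                 (P.+-identityʳ 1#))
      ; W-eq = P.refl
      }
      where
      0*1 : const R.0# * 1# ≈ 0#
      0*1 = mk≈ λ n → R.trans (const-* R.0# 1# n) (R.zeroˡ _)
    factorisation (suc m) α α+m≡r = record
      { X-eq = proj₁ step
      ; U-eq = proj₂ step
      ; W-eq = P.refl
      }
      where
      open Factorisation (factorisation m (suc α) (≡.trans (≡.sym (ℕₚ.+-suc α m)) α+m≡r))
      α<r : α < r
      α<r = ≡.subst (α <_) α+m≡r (ℕₚ.m<m+n α (ℕ.s≤s ℕ.z≤n))
      -- Here y′ is e′ α but x′ is o′ (suc α): the new odd weight of the deeper level comes from the
      -- old odd weight of this one.
      step = P.evolution-step X-eq U-eq (continuedFraction-one o e m (suc α)) H′-eq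
        (P.trans (const-cong (s-split α α<r)) (const-+ _ _))
        (P.trans (P.sym (const-homo-* (s α) (i α))) (const-cong (s-inv α α<r)))
        (const-relation (e′-eq α α<r))
        (const-relation (o′-eq α α<r))

    -- Outermost there is no further odd weight to split off; o′ 0 = s 0 makes H U the new continued
    -- fraction itself.
    continuedFraction-evolution : continuedFraction o e r 0 1 ≈
      1# + t * (const (o′ 0) * continuedFraction o′ e′ r 0 1)
    continuedFraction-evolution = P.evolution-top X-eq U-eq (continuedFraction-one o e r 0) H′-eq
      (const-cong o′-zero)
      where open Factorisation (factorisation r 0 ≡.refl)

-- Sums over compositions as coefficients of the continued fraction.

module FiniteSums (R : CommutativeRing c ℓ) where
  open CommutativeRing R renaming (Carrier to A)

  ∑ : ∀ {I : Set} → List I → (I → A) → A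
  ∑ is f = foldr _+_ 0# (map f is)

  ∏ : ℕ → (ℕ → A) → A
  ∏ zero    f = 1#
  ∏ (suc m) f = ∏ m f * f (suc m)

  ∑-cong : ∀ {I : Set} (is : List I) {f g} → (∀ i → f i ≈ g i) → ∑ is f ≈ ∑ is g
  ∑-cong []       e = refl
  ∑-cong (i ∷ is) e = +-cong (e i) (∑-cong is e)

  ∑-++ : ∀ {I : Set} (is js : List I) f → ∑ (is ++ js) f ≈ ∑ is f + ∑ js f
  ∑-++ []       js f = sym (+-identityˡ _)
  ∑-++ (i ∷ is) js f = trans (+-congˡ (∑-++ is js f)) (sym (+-assoc _ _ _))

  ∑-map : ∀ {I J : Set} (g : I → J) is f → ∑ (map g is) f ≡ ∑ is (λ i → f (g i))
  ∑-map g is f = ≡.cong (foldr _+_ 0#) (≡.sym (Listₚ.map-∘ is))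

  ∑-concatMap : ∀ {I J : Set} (g : I → List J) is f →
    ∑ (concatMap g is) f ≈ ∑ is (λ i → ∑ (g i) f)
  ∑-concatMap g []       f = refl
  ∑-concatMap g (i ∷ is) f = trans (∑-++ (g i) _ f) (+-congˡ (∑-concatMap g is f))

  ∑-*ˡ : ∀ {I : Set} x (is : List I) f → ∑ is (λ i → x * f i) ≈ x * ∑ is f
  ∑-*ˡ x []       f = sym (zeroʳ x)
  ∑-*ˡ x (i ∷ is) f = trans (+-congˡ (∑-*ˡ x is f)) (sym (distribˡ _ _ _))

  ∏-cong : ∀ m {f g} → (∀ i → i < m → f (suc i) ≈ g (suc i)) → ∏ m f ≈ ∏ m g
  ∏-cong zero    e = refl
  ∏-cong (suc m) e = *-cong (∏-cong m (λ i i<m → e i (ℕₚ.m<n⇒m<1+n i<m))) (e m (ℕₚ.n<1+n m))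

  ∏-head : ∀ m f → ∏ (suc m) f ≈ f 1 * ∏ m (λ i → f (suc i))
  ∏-head zero    f = *-comm _ _
  ∏-head (suc m) f = trans (*-congʳ (∏-head m f)) (*-assoc _ _ _)

module CompositionSums (R : CommutativeRing c ℓ) where
  open CommutativeRing R renaming (Carrier to A)
  open FiniteSums R
  open Algebra.Properties.CommutativeSemiring.Exp commutativeSemiring
  open Algebra.Properties.Semiring.Mult semiring using () renaming (_×_ to _times_)
  open Algebra.Solver.Ring.NaturalCoefficients.Default commutativeSemiring
    using (solve; _:=_; _:+_; _:*_; con)
  open Relation.Binary.Reasoning.Setoid setoid
  private
    module S = PowerSeries R
  open S using (Series; powerSum; powerSum-cong; const; const-*; trinomialWeight)
  open ContinuedFraction R using (continuedFraction)

  ∑-upTo : ∀ (F : ℕ → Series) n → ∑ (upTo (suc n)) (λ j → F j (n ℕ.∸ j)) ≈ powerSum F n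
  ∑-upTo F n = trans (reflexive (≡.cong (foldr _+_ 0#)
      (Listₚ.map-upTo (λ j → F j (n ℕ.∸ j)) (suc n)))) (go F n)
    where
    go : ∀ F n → foldr _+_ 0# (applyUpTo (λ j → F j (n ℕ.∸ j)) (suc n)) ≈ powerSum F n
    go F zero    = +-identityʳ _
    go F (suc n) = +-congˡ (go (λ j → F (suc j)) n)

  -- As a series in the total n, splitting off a first part j contributes tʲ.
  ∑-compositions : ∀ k n (f : Vec ℕ (suc k) → A) →
    ∑ (compositions (suc k) n) f ≈ powerSum (λ j n → ∑ (compositions k n) (λ v → f (j ∷ v))) n
  ∑-compositions k n f = begin
    ∑ (compositions (suc k) n) f
      ≈⟨ ∑-concatMap (λ j → map (j ∷_) (compositions k (n ℕ.∸ j))) (upTo (suc n)) f ⟩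
    ∑ (upTo (suc n)) (λ j → ∑ (map (j ∷_) (compositions k (n ℕ.∸ j))) f)
      ≈⟨ ∑-cong (upTo (suc n)) (λ j → reflexive (∑-map (j ∷_) (compositions k (n ℕ.∸ j)) f)) ⟩
    ∑ (upTo (suc n)) (λ j → ∑ (compositions k (n ℕ.∸ j)) (λ v → f (j ∷ v)))
      ≈⟨ ∑-upTo (λ j n → ∑ (compositions k n) (λ v → f (j ∷ v))) n ⟩
    _ ∎

  fromℕ : ℕ → A
  fromℕ n = n times 1#

  trinomialFactor : (ℕ → ℕ) → ℕ → A
  trinomialFactor p i = fromℕ (trinomial (p (i ℕ.* 2)) (p (1 ℕ.+ i ℕ.* 2)) (p (2 ℕ.+ i ℕ.* 2)))

  module _ (o e : ℕ → A) where

    -- The vector is read in pairs, one per level: b and d are the exponents of o α and e α, and d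
    -- is also the power to which the next level is raised.
    pathWeight : ℕ → ℕ → ∀ {k} → Vec ℕ k → A
    pathWeight α a []          = 1#
    pathWeight α a (b ∷ [])    = o α ^ b * fromℕ (trinomial a b 0)
    pathWeight α a (b ∷ d ∷ v) = trinomialWeight (o α) (e α) a b d * pathWeight (suc α) d v

    ∑-pathWeight : ∀ m α a n →
      ∑ (compositions (suc (m ℕ.* 2)) n) (pathWeight α a) ≈ continuedFraction o e m α a n
    ∑-pathWeight zero α a n = trans (∑-compositions 0 n (pathWeight α a))
      (S.at (powerSum-cong λ b → S.mk≈ (row b)) n)
      where
      row : ∀ b n → ∑ (compositions 0 n) (λ v → pathWeight α a (b ∷ v)) ≈
        powerSum (λ d → const (trinomialWeight (o α) 0# a b d) S.* S.1#) n
      row b n = sym (begin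
        powerSum (λ d → const (w d) S.* S.1#) n
          -- The even weight is 0 at the last level, so all d > 0 contribute nothing.
          ≈⟨ S.at (S.powerSum-head {λ d → const (w d) S.* S.1#} λ d → S.mk≈ λ n →
              trans (const-* (w (suc d)) S.1# n)
               (trans (*-congʳ (solve 3 (λ x y z → x :* (con 0 :* y :* z) := con 0) refl (o α ^ b)
                   (0# ^ d) (fromℕ (trinomial a b (suc d)))))
                 (zeroˡ _))) n ⟩
        (const (w 0) S.* S.1#) n                     ≈⟨ const-* (w 0) S.1# n ⟩
        w 0 * S.1# n                                 ≈⟨ single n ⟩
        ∑ (compositions 0 n) (λ v → pathWeight α a (b ∷ v)) ∎)
        where
        w : ℕ → A
        w = trinomialWeight (o α) 0# a b
        single : ∀ n → w 0 * S.1# n ≈ ∑ (compositions 0 n) (λ v → pathWeight α a (b ∷ v))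
        single zero    = solve 2 (λ x y → x :* (con 1 :* y) :* con 1 := x :* y :+ con 0) refl
            (o α ^ b) (fromℕ (trinomial a b 0))
        single (suc n) = zeroʳ _
    ∑-pathWeight (suc m) α a n = trans (∑-compositions (suc (suc (m ℕ.* 2))) n (pathWeight α a))
      (S.at (powerSum-cong λ b → S.mk≈ λ n →
        trans (∑-compositions (suc (m ℕ.* 2)) n (λ v → pathWeight α a (b ∷ v)))
          (S.at (powerSum-cong λ d → S.mk≈ λ n → row b d n) n)) n)
      where
      row : ∀ b d n → ∑ (compositions (suc (m ℕ.* 2)) n) (λ v → pathWeight α a (b ∷ d ∷ v)) ≈
        (const (trinomialWeight (o α) (e α) a b d) S.* continuedFraction o e m (suc α) d) n
      row b d n = begin
        _ ≈⟨ ∑-*ˡ w (compositions (suc (m ℕ.* 2)) n) (pathWeight (suc α) d) ⟩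
        _ ≈⟨ *-congˡ (∑-pathWeight m (suc α) d n) ⟩
        _ ≈⟨ const-* w (continuedFraction o e m (suc α) d) n ⟨
        _ ∎
        where
        w = trinomialWeight (o α) (e α) a b d

    -- The index i of ∏ starts from 1.
    monomial : (ℕ → ℕ) → ℕ → ℕ → A
    monomial p α i =
      o (ℕ.pred i ℕ.+ α) ^ p (1 ℕ.+ ℕ.pred i ℕ.* 2) * e (ℕ.pred i ℕ.+ α) ^ p (2 ℕ.+ ℕ.pred i ℕ.* 2)

    -- Removing the first pair raises the level by one and lowers the indices of p by two. The
    -- outermost trinomial stands apart because its power `a` is not an entry of p.
    pathWeight-∏ : ∀ m α a (v : Vec ℕ (suc (m ℕ.* 2))) → let p = entry v in
      pathWeight α a v ≈
        ∏ m (monomial p α) * o (m ℕ.+ α) ^ p (1 ℕ.+ m ℕ.* 2)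
          * fromℕ (trinomial a (p 1) (p 2)) * ∏ m (trinomialFactor p)
    pathWeight-∏ zero    α a (b ∷ []) =
      solve 2 (λ x y → x :* y := con 1 :* x :* y :* con 1) refl (o α ^ b) (fromℕ (trinomial a b 0))
    pathWeight-∏ (suc m) α a (b ∷ d ∷ v) = begin
      x * (y * z) * pathWeight (suc α) d v
        ≈⟨ *-congˡ (pathWeight-∏ m (suc α) d v) ⟩
      x * (y * z) * (∏ m (monomial p′ (suc α)) * o (m ℕ.+ suc α) ^ p′ (1 ℕ.+ m ℕ.* 2) * q *
          ∏ m (trinomialFactor p′))
        ≈⟨ *-congˡ (*-cong (*-congʳ (*-cong (∏-cong m λ j _ →
            reflexive (≡.cong₂ _*_ (o-shift j) (e-shift j)))
             (reflexive (o-shift m)))) (∏-cong m λ _ _ → refl)) ⟩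
      x * (y * z) * (M * l * q * N)
        ≈⟨ solve 7 (λ x y z m l q n → x :* (y :* z) :* (m :* l :* q :* n) :=
            x :* y :* m :* l :* z :* (q :* n))
             refl x y z M l q N ⟩
      x * y * M * l * z * (q * N)
        ≈⟨ *-cong (*-congʳ (*-congʳ (∏-head m (monomial p α)))) (∏-head m (trinomialFactor p)) ⟨
      _ ∎
      where
      p  = entry (b ∷ d ∷ v)
      p′ = entry v
      x = o α ^ b
      y = e α ^ d
      z = fromℕ (trinomial a b d)
      q = fromℕ (trinomial d (p′ 1) (p′ 2))
      l = o (suc m ℕ.+ α) ^ p (1 ℕ.+ suc m ℕ.* 2)
      M = ∏ m (λ i → monomial p α (suc i))
      N = ∏ m (λ i → trinomialFactor p (suc i))
      o-shift : ∀ j → o (j ℕ.+ suc α) ^ p′ (1 ℕ.+ j ℕ.* 2) ≡ o (suc j ℕ.+ α) ^ p (1 ℕ.+ suc j ℕ.* 2)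
      o-shift j = ≡.cong (λ k → o k ^ p′ (1 ℕ.+ j ℕ.* 2)) (ℕₚ.+-suc j α)
      e-shift : ∀ j → e (j ℕ.+ suc α) ^ p′ (2 ℕ.+ j ℕ.* 2) ≡ e (suc j ℕ.+ α) ^ p (2 ℕ.+ suc j ℕ.* 2)
      e-shift j = ≡.cong (λ k → e k ^ p′ (2 ℕ.+ j ℕ.* 2)) (ℕₚ.+-suc j α)

-- Telescoping of the exponents.

module Telescoping (R : CommutativeRing c ℓ) where
  open CommutativeRing R renaming (Carrier to A)
  open FiniteSums R
  open CompositionSums R using (monomial)
  open Algebra.Properties.CommutativeSemiring.Exp commutativeSemiring
  open Algebra.Solver.Ring.NaturalCoefficients.Default commutativeSemiring
    using (solve; _:=_; _:+_; _:*_; con)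
  open Relation.Binary.Reasoning.Setoid setoid

  one-^ : ∀ {x} → x ≈ 1# → ∀ n → x ^ n ≈ 1#
  one-^ e zero    = refl
  one-^ e (suc n) = trans (*-cong e (one-^ e n)) (*-identityˡ 1#)

  ^-inverse : ∀ {x y} → x * y ≈ 1# → ∀ n → x ^ n * y ^ n ≈ 1#
  ^-inverse {x} {y} e n = begin
    x ^ n * y ^ n ≈⟨ ^-distrib-* x y n ⟨
    (x * y) ^ n   ≈⟨ one-^ e n ⟩
    1#            ∎

  module _ (u ū w w̄ : ℕ → A) where

    -- With u = R_(·,0), w = R_(·,1) and bars for inverses these are y_(2j+1) = R_(j+1,1) R_(j,0) /
    -- (R_(j+1,0) R_(j,1)) and y_(2j+2) = R_(j+2,1) R_(j,0) / (R_(j+1,0) R_(j+1,1)).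
    oddStep evenStep : ℕ → A
    oddStep  j = w (suc j) * u j * ū (suc j) * w̄ j
    evenStep j = w (2 ℕ.+ j) * u j * ū (suc j) * w̄ (suc j)

    module _ (p : ℕ → ℕ) where

      -- The i-th quotient of the theorem with positive and negative exponents collected separately,
      -- so that only natural powers occur.
      exponentFactor : ℕ → A
      exponentFactor i =
        u i ^ (p (2 ℕ.+ i ℕ.* 2) ℕ.+ p (1 ℕ.+ i ℕ.* 2)) * ū i ^ (p (i ℕ.* 2) ℕ.+ p (i ℕ.* 2 ℕ.∸ 1))
          * (w i ^ (p (i ℕ.* 2 ℕ.∸ 1) ℕ.+ p (i ℕ.* 2 ℕ.∸ 2)) *
              w̄ i ^ (p (1 ℕ.+ i ℕ.* 2) ℕ.+ p (i ℕ.* 2)))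

      -- The discrepancy after m factors: the powers of u m and w̄ m belong to weights of level m,
      -- and w̄ (m + 1) compensates the w (m + 1) in the preceding even weight.
      remainder : ℕ → A
      remainder m = u m ^ (p (2 ℕ.+ m ℕ.* 2) ℕ.+ p (1 ℕ.+ m ℕ.* 2))
        * (w̄ (suc m) ^ p (m ℕ.* 2) * w̄ m ^ p (1 ℕ.+ m ℕ.* 2))

      ∏-exponentFactor : p 0 ≡ 0 → u 0 ≈ 1# → w̄ 0 ≈ 1# → ∀ m →
          (∀ j → j ≤ suc m → w j * w̄ j ≈ 1#) →
        ∏ m exponentFactor ≈ ∏ m (monomial oddStep evenStep p 0) * remainder m
      ∏-exponentFactor p₀ u₀ w̄₀ zero inverse = sym (begin
        1# * (u 0 ^ (p 2 ℕ.+ p 1) * (w̄ 1 ^ p 0 * w̄ 0 ^ p 1))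
          ≈⟨ *-congˡ (*-cong (one-^ u₀ (p 2 ℕ.+ p 1))
              (*-cong (^-congʳ (w̄ 1) p₀) (one-^ w̄₀ (p 1)))) ⟩
        1# * (1# * (1# * 1#))
          ≈⟨ solve 0 (con 1 :* (con 1 :* (con 1 :* con 1)) := con 1) refl ⟩
        1# ∎)
      ∏-exponentFactor p₀ u₀ w̄₀ (suc m) inverse = begin
        ∏ m exponentFactor * exponentFactor (suc m)
          ≈⟨ *-congʳ (∏-exponentFactor p₀ u₀ w̄₀ m (λ j j≤ → inverse j (ℕₚ.m≤n⇒m≤1+n j≤))) ⟩
        M * remainder m * exponentFactor (suc m)
          ≈⟨ *-assoc _ _ _ ⟩
        M * (remainder m * exponentFactor (suc m))
          ≈⟨ *-congˡ step ⟩
        M * (oddStep m ^ b * evenStep m ^ d * remainder (suc m))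
          ≈⟨ *-assoc _ _ _ ⟨
        M * (oddStep m ^ b * evenStep m ^ d) * remainder (suc m)
          ≈⟨ *-congʳ (*-congˡ (reflexive (≡.cong (λ k → oddStep k ^ b * evenStep k ^ d)
              (≡.sym (ℕₚ.+-identityʳ m))))) ⟩
        M * monomial oddStep evenStep p 0 (suc m) * remainder (suc m) ∎
        where
        M = ∏ m (monomial oddStep evenStep p 0)
        a = p (m ℕ.* 2)
        b = p (1 ℕ.+ m ℕ.* 2)
        d = p (2 ℕ.+ m ℕ.* 2)
        f = p (3 ℕ.+ m ℕ.* 2)
        g = p (4 ℕ.+ m ℕ.* 2)
        u₁ = u (suc m)
        ū₁ = ū (suc m)
        w₁ = w (suc m)
        w̄₁ = w̄ (suc m)
        w₂ = w (suc (suc m))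
        w̄₂ = w̄ (suc (suc m))
        X = u₁ ^ (g ℕ.+ f) * (w̄₁ ^ f * w̄₁ ^ d) * (ū₁ ^ d * ū₁ ^ b) * w₁ ^ b *
            (u m ^ d * u m ^ b) * w̄ m ^ b
        split-product : ∀ x y z v n → (x * y * z * v) ^ n ≈ x ^ n * y ^ n * z ^ n * v ^ n
        split-product x y z v n = trans (^-distrib-* _ v n)
            (*-congʳ (trans (^-distrib-* _ z n) (*-congʳ (^-distrib-* x y n))))
        step : remainder m * exponentFactor (suc m) ≈
            oddStep m ^ b * evenStep m ^ d * remainder (suc m)
        step = begin
          remainder m * exponentFactor (suc m)
            ≈⟨ *-cong (*-congʳ (^-homo-* (u m) d b))
                 (*-cong (*-congˡ (^-homo-* ū₁ d b))
                     (*-cong (^-homo-* w₁ b a) (^-homo-* w̄₁ f d))) ⟩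
          u m ^ d * u m ^ b * (w̄₁ ^ a * w̄ m ^ b)
            * (u₁ ^ (g ℕ.+ f) * (ū₁ ^ d * ū₁ ^ b) * (w₁ ^ b * w₁ ^ a * (w̄₁ ^ f * w̄₁ ^ d)))
            ≈⟨ solve 8 (λ u k h U V x y W → u :* (k :* h) :* (U :* V :* (x :* y :* W))
                 := U :* W :* V :* x :* u :* h :* (y :* k)) refl
                 (u m ^ d * u m ^ b) (w̄₁ ^ a) (w̄ m ^ b) (u₁ ^ (g ℕ.+ f)) (ū₁ ^ d * ū₁ ^ b)
                     (w₁ ^ b) (w₁ ^ a) (w̄₁ ^ f * w̄₁ ^ d) ⟩
          X * (w₁ ^ a * w̄₁ ^ a)
            -- The compensated power of w₁ cancels, and a trivial power of w₂ is inserted because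
            -- `evenStep m` contains w₂ while the factor of index m + 1 does not.
            ≈⟨ *-congˡ (trans (^-inverse (inverse (suc m) (ℕₚ.n≤1+n _)) a)
                (sym (^-inverse (inverse (suc (suc m)) ℕₚ.≤-refl) d))) ⟩
          X * (w₂ ^ d * w̄₂ ^ d)
            ≈⟨ solve 12 (λ U F D ū₁ ū₂ x u₁ u₂ h y k _ →
                 U :* (F :* D) :* (ū₁ :* ū₂) :* x :* (u₁ :* u₂) :* h :* (y :* k)
                 := (x :* u₂ :* ū₂ :* h) :* (y :* u₁ :* ū₁ :* D) :* (U :* (k :* F))) refl
                 (u₁ ^ (g ℕ.+ f)) (w̄₁ ^ f) (w̄₁ ^ d) (ū₁ ^ d) (ū₁ ^ b) (w₁ ^ b) (u m ^ d) (u m ^ b)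
                     (w̄ m ^ b) (w₂ ^ d) (w̄₂ ^ d) 1# ⟩
          w₁ ^ b * u m ^ b * ū₁ ^ b * w̄ m ^ b * (w₂ ^ d * u m ^ d * ū₁ ^ d * w̄₁ ^ d) *
              (u₁ ^ (g ℕ.+ f) * (w̄₂ ^ d * w̄₁ ^ f))
            ≈⟨ *-congʳ (*-cong (split-product w₁ (u m) ū₁ (w̄ m) b)
                (split-product w₂ (u m) ū₁ w̄₁ d)) ⟨
          oddStep m ^ b * evenStep m ^ d * remainder (suc m) ∎

entry-last : ∀ {k} (v : Vec ℕ k) → entry v (suc k) ≡ 0
entry-last []      = ≡.refl
entry-last (x ∷ v) = entry-last v

module Units (R : CommutativeRing c ℓ) where
  open CommutativeRing R

  *-cancel-unit : ∀ x y z → y * z ≈ 1# → x * y * z ≈ x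
  *-cancel-unit x y z e = trans (*-assoc x y z) (trans (*-congˡ e) (*-identityʳ x))

-- Positivity of the solution.

module PositiveQSystem (R : CommutativeRing c ℓ) where
  open CommutativeRing R renaming (Carrier to A)

  module Solutions {p}
    (Positive : A → Set p)
    (resp : ∀ {x y} → x ≈ y → Positive x → Positive y)
    (positive-1 : Positive 1#)
    (positive-+ : ∀ {x y} → Positive x → Positive y → Positive (x + y))
    (positive-* : ∀ {x y} → Positive x → Positive y → Positive (x * y))
    (positive-divide : ∀ {x y} → Positive (x * y) → Positive y → Positive x)
    (r : ℕ) (ρ : ℕ → ℕ → A)
    (initial₀ : ∀ (i : Fin r) → Positive (ρ (suc (toℕ i)) 0))
    (initial₁ : ∀ (i : Fin r) → Positive (ρ (suc (toℕ i)) 1))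
    (boundary₀ : ∀ n → ρ 0 n ≈ 1#) (boundary₁ : ∀ n → ρ (suc r) n ≈ 1#)
    (recursion : ∀ α n → α < r → ρ (suc α) (2 ℕ.+ n) * ρ (suc α) n ≈
      ρ (suc α) (1 ℕ.+ n) * ρ (suc α) (1 ℕ.+ n) + ρ (2 ℕ.+ α) (1 ℕ.+ n) * ρ α (1 ℕ.+ n)) where

    positive-rows : ∀ n → (∀ (i : Fin r) → Positive (ρ (suc (toℕ i)) n)) → ∀ α → α ≤ suc r →
        Positive (ρ α n)
    positive-rows n interior zero    _  = resp (sym (boundary₀ n)) positive-1
    positive-rows n interior (suc α) α< with ℕₚ.m≤n⇒m<n∨m≡n (ℕₚ.≤-pred α<)
    ... | inj₁ α<r    = ≡.subst (λ β → Positive (ρ (suc β) n)) (Finₚ.toℕ-fromℕ< α<r)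
        (interior (fromℕ< α<r))
    ... | inj₂ ≡.refl = resp (sym (boundary₁ n)) positive-1

    -- The right side of the recursion has no subtraction, so the new value times an earlier
    -- positive one is positive.
    positive-step : ∀ n → (∀ α → α ≤ suc r → Positive (ρ α n)) →
      (∀ α → α ≤ suc r → Positive (ρ α (suc n))) → ∀ α → α < r → Positive (ρ (suc α) (2 ℕ.+ n))
    positive-step n now next α α<r = positive-divide
      (resp (sym (recursion α n α<r)) (positive-+
        (positive-* (next (suc α) α<) (next (suc α) α<))
        (positive-* (next (2 ℕ.+ α) (ℕ.s≤s α<r)) (next α (ℕₚ.<⇒≤ α<)))))
      (now (suc α) α<)
      where
      α< = ℕₚ.m≤n⇒m≤1+n α<r

    positive-ρ : ∀ n α → α ≤ suc r → Positive (ρ α n)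
    positive-ρ zero          = positive-rows 0 initial₀
    positive-ρ (suc zero)    = positive-rows 1 initial₁
    positive-ρ (suc (suc n)) = positive-rows (2 ℕ.+ n) λ i →
      positive-step n (positive-ρ n) (positive-ρ (suc n)) (toℕ i) (Finₚ.toℕ<n i)

-- The Q-system as an evolution of continued fraction weights.

module InvertibleQSystem (R : CommutativeRing c ℓ) where
  open CommutativeRing R renaming (Carrier to A)
  open Algebra.Solver.Ring.NaturalCoefficients.Default commutativeSemiring
    using (solve; _:=_; _:+_; _:*_; con)
  open Relation.Binary.Reasoning.Setoid setoid
  open ContinuedFraction R using (continuedFraction; module Evolution)
  open Telescoping R
  open FiniteSums R
  open CompositionSums R
  open Algebra.Properties.CommutativeSemiring.Exp commutativeSemiring
  private module S = PowerSeries R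

  unit-inverse : ∀ {x y} → x ≈ 1# → x * y ≈ 1# → y ≈ 1#
  unit-inverse {x} {y} x≈1 e = trans (sym (*-identityˡ y)) (trans (*-congʳ (sym x≈1)) e)

  absorb : ∀ {z x x̄ y ȳ} → x * x̄ ≈ 1# → y * ȳ ≈ 1# → z * (x * x̄) * (y * ȳ) ≈ z
  absorb e f = trans (*-cong (trans (*-congˡ e) (*-identityʳ _)) f) (*-identityʳ _)

  module _ (r : ℕ) (ρ ρ̄ : ℕ → ℕ → A)
    (inverse : ∀ α n → α ≤ suc r → ρ α n * ρ̄ α n ≈ 1#)
    (boundary₀ : ∀ n → ρ 0 n ≈ 1#) (boundary₁ : ∀ n → ρ (suc r) n ≈ 1#)
    (recursion : ∀ α n → α < r → ρ (suc α) (2 ℕ.+ n) * ρ (suc α) n ≈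
      ρ (suc α) (1 ℕ.+ n) * ρ (suc α) (1 ℕ.+ n) + ρ (2 ℕ.+ α) (1 ℕ.+ n) * ρ α (1 ℕ.+ n)) where

    o e s s̄ : ℕ → ℕ → A
    o n = oddStep  (λ α → ρ α n) (λ α → ρ̄ α n) (λ α → ρ α (suc n)) (λ α → ρ̄ α (suc n))
    e n = evenStep (λ α → ρ α n) (λ α → ρ̄ α n) (λ α → ρ α (suc n)) (λ α → ρ̄ α (suc n))
    s n α = ρ α n * ρ (suc α) (2 ℕ.+ n) * (ρ̄ α (suc n) * ρ̄ (suc α) (suc n))
    s̄ n α = ρ̄ α n * ρ̄ (suc α) (2 ℕ.+ n) * (ρ α (suc n) * ρ (suc α) (suc n))

    private
      ρ̄₀ : ∀ n → ρ̄ 0 n ≈ 1#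
      ρ̄₀ n = unit-inverse (boundary₀ n) (inverse 0 n ℕ.z≤n)

      ρ̄₁ : ∀ n → ρ̄ (suc r) n ≈ 1#
      ρ̄₁ n = unit-inverse (boundary₁ n) (inverse (suc r) n ℕₚ.≤-refl)

    -- Over a common denominator the numerator of o + e contains the right side of the recursion. Of
    -- the relations required by `Evolution` only this one uses the recursion.
    s-split : ∀ n α → α < r → s n α ≈ o n α + e n α
    s-split n α α<r = sym (begin
      b₁ * a₀ * b̄₀ * ā₁ + d₁ * a₀ * b̄₀ * b̄₁
        ≈⟨ +-cong (*-identityʳ _) (*-identityʳ _) ⟨
      b₁ * a₀ * b̄₀ * ā₁ * 1# + d₁ * a₀ * b̄₀ * b̄₁ * 1#
        ≈⟨ +-cong (*-congˡ (inverse (suc α) (suc n) (ℕₚ.m≤n⇒m≤1+n α<r)))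
            (*-congˡ (inverse α (suc n) (ℕₚ.m≤n⇒m≤1+n (ℕₚ.<⇒≤ α<r)))) ⟨
      b₁ * a₀ * b̄₀ * ā₁ * (b₁ * b̄₁) + d₁ * a₀ * b̄₀ * b̄₁ * (a₁ * ā₁)
        ≈⟨ solve 7 (λ a₀ a₁ ā₁ b̄₀ b₁ b̄₁ d₁ →
             b₁ :* a₀ :* b̄₀ :* ā₁ :* (b₁ :* b̄₁) :+ d₁ :* a₀ :* b̄₀ :* b̄₁ :* (a₁ :* ā₁)
             := a₀ :* b̄₀ :* ā₁ :* b̄₁ :* (b₁ :* b₁ :+ d₁ :* a₁)) refl a₀ a₁ ā₁ b̄₀ b₁ b̄₁ d₁ ⟩
      a₀ * b̄₀ * ā₁ * b̄₁ * (b₁ * b₁ + d₁ * a₁)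
        ≈⟨ *-congˡ (recursion α n α<r) ⟨
      a₀ * b̄₀ * ā₁ * b̄₁ * (b₂ * b₀)
        ≈⟨ solve 6 (λ a₀ ā₁ b₀ b̄₀ b̄₁ b₂ → a₀ :* b̄₀ :* ā₁ :* b̄₁ :* (b₂ :* b₀)
             := a₀ :* b₂ :* (ā₁ :* b̄₁) :* (b₀ :* b̄₀)) refl a₀ ā₁ b₀ b̄₀ b̄₁ b₂ ⟩
      s n α * (b₀ * b̄₀)
        ≈⟨ trans (*-congˡ (inverse (suc α) n (ℕₚ.m≤n⇒m≤1+n α<r))) (*-identityʳ _) ⟩
      s n α ∎)
      where
      a₀ = ρ α n
      a₁ = ρ α (suc n)
      ā₁ = ρ̄ α (suc n)
      b₀ = ρ (suc α) n
      b̄₀ = ρ̄ (suc α) n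
      b₁ = ρ (suc α) (suc n)
      b̄₁ = ρ̄ (suc α) (suc n)
      b₂ = ρ (suc α) (suc (suc n))
      d₁ = ρ (suc (suc α)) (suc n)

    s-last : ∀ n → s n r ≈ o n r
    s-last n = begin
      ρ r n * ρ (suc r) (2 ℕ.+ n) * (ρ̄ r (suc n) * ρ̄ (suc r) (suc n))
        ≈⟨ *-cong (*-congˡ (trans (boundary₁ _) (sym (boundary₁ (suc n)))))
            (*-congˡ (trans (ρ̄₁ _) (sym (ρ̄₁ n)))) ⟩
      ρ r n * ρ (suc r) (suc n) * (ρ̄ r (suc n) * ρ̄ (suc r) n)
        ≈⟨ solve 4 (λ x y z w → x :* y :* (z :* w) := y :* x :* w :* z) refl _ _ _ _ ⟩
      o n r ∎

    s-inverse : ∀ n α → α < r → s n α * s̄ n α ≈ 1#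
    s-inverse n α α<r = begin
      s n α * s̄ n α
        ≈⟨ solve 8 (λ a b c d a′ b′ c′ d′ → a :* b :* (c :* d) :* (a′ :* b′ :* (c′ :* d′))
             := a :* a′ :* (b :* b′) :* (c′ :* c :* (d′ :* d))) refl
             (ρ α n) (ρ (suc α) (2 ℕ.+ n)) (ρ̄ α (suc n)) (ρ̄ (suc α) (suc n))
             (ρ̄ α n) (ρ̄ (suc α) (2 ℕ.+ n)) (ρ α (suc n)) (ρ (suc α) (suc n)) ⟩
      _ ≈⟨ *-cong (*-cong (inverse α n α≤) (inverse (suc α) (2 ℕ.+ n) α<))
          (*-cong (inverse α (suc n) α≤) (inverse (suc α) (suc n) α<)) ⟩
      1# * 1# * (1# * 1#)
        ≈⟨ solve 0 (con 1 :* con 1 :* (con 1 :* con 1) := con 1) refl ⟩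
      1# ∎
      where
      α< = ℕₚ.m≤n⇒m≤1+n α<r
      α≤ = ℕₚ.<⇒≤ α<

    -- A monomial identity: both sides are ρ (α+2) (n+2) ρ α n / ρ (α+1) (n+1)².
    e-evolution : ∀ n α → α < r → e (suc n) α * s n α ≈ e n α * s n (suc α)
    e-evolution n α α<r = begin
      d₂ * a₁ * b̄₁ * b̄₂ * (a₀ * b₂ * (ā₁ * b̄₁))
        ≈⟨ solve 7 (λ a₀ a₁ ā₁ b̄₁ b₂ b̄₂ d₂ → d₂ :* a₁ :* b̄₁ :* b̄₂ :* (a₀ :* b₂ :* (ā₁ :* b̄₁))
             := d₂ :* a₀ :* b̄₁ :* b̄₁ :* (a₁ :* ā₁) :* (b₂ :* b̄₂)) refl a₀ a₁ ā₁ b̄₁ b₂ b̄₂ d₂ ⟩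
      d₂ * a₀ * b̄₁ * b̄₁ * (a₁ * ā₁) * (b₂ * b̄₂)
        ≈⟨ absorb (inverse α (suc n) (ℕₚ.<⇒≤ α<)) (inverse (suc α) (2 ℕ.+ n) α<) ⟩
      d₂ * a₀ * b̄₁ * b̄₁
        ≈⟨ absorb (inverse (suc α) n α<) (inverse (2 ℕ.+ α) (suc n) (ℕ.s≤s α<r)) ⟨
      d₂ * a₀ * b̄₁ * b̄₁ * (b₀ * b̄₀) * (d₁ * d̄₁)
        ≈⟨ solve 7 (λ a₀ b₀ b̄₀ b̄₁ d₁ d̄₁ d₂ → d₂ :* a₀ :* b̄₁ :* b̄₁ :* (b₀ :* b̄₀) :* (d₁ :* d̄₁)
             := d₁ :* a₀ :* b̄₀ :* b̄₁ :* (b₀ :* d₂ :* (b̄₁ :* d̄₁))) refl a₀ b₀ b̄₀ b̄₁ d₁ d̄₁ d₂ ⟩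
      d₁ * a₀ * b̄₀ * b̄₁ * (b₀ * d₂ * (b̄₁ * d̄₁)) ∎
      where
      α< = ℕₚ.m≤n⇒m≤1+n α<r
      a₀ = ρ α n
      a₁ = ρ α (suc n)
      ā₁ = ρ̄ α (suc n)
      b₀ = ρ (suc α) n
      b̄₀ = ρ̄ (suc α) n
      b̄₁ = ρ̄ (suc α) (suc n)
      b₂ = ρ (suc α) (suc (suc n))
      b̄₂ = ρ̄ (suc α) (suc (suc n))
      d₁ = ρ (suc (suc α)) (suc n)
      d̄₁ = ρ̄ (suc (suc α)) (suc n)
      d₂ = ρ (suc (suc α)) (suc (suc n))

    o-evolution : ∀ n α → α < r → o (suc n) (suc α) * s n α ≈ o n α * s n (suc α)
    o-evolution n α α<r = begin
      d₂ * b₁ * d̄₁ * b̄₂ * (a₀ * b₂ * (ā₁ * b̄₁))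
        ≈⟨ solve 8 (λ a₀ ā₁ b₁ b̄₁ b₂ b̄₂ d̄₁ d₂ →
            d₂ :* b₁ :* d̄₁ :* b̄₂ :* (a₀ :* b₂ :* (ā₁ :* b̄₁))
             := d₂ :* a₀ :* d̄₁ :* ā₁ :* (b₁ :* b̄₁) :* (b₂ :* b̄₂)) refl a₀ ā₁ b₁ b̄₁ b₂ b̄₂ d̄₁
                 d₂ ⟩
      d₂ * a₀ * d̄₁ * ā₁ * (b₁ * b̄₁) * (b₂ * b̄₂)
        ≈⟨ absorb (inverse (suc α) (suc n) α<) (inverse (suc α) (2 ℕ.+ n) α<) ⟩
      d₂ * a₀ * d̄₁ * ā₁
        ≈⟨ absorb (inverse (suc α) (suc n) α<) (inverse (suc α) n α<) ⟨
      d₂ * a₀ * d̄₁ * ā₁ * (b₁ * b̄₁) * (b₀ * b̄₀)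
        ≈⟨ solve 8 (λ a₀ ā₁ b₀ b̄₀ b₁ b̄₁ d̄₁ d₂ →
            d₂ :* a₀ :* d̄₁ :* ā₁ :* (b₁ :* b̄₁) :* (b₀ :* b̄₀)
             := b₁ :* a₀ :* b̄₀ :* ā₁ :* (b₀ :* d₂ :* (b̄₁ :* d̄₁))) refl a₀ ā₁ b₀ b̄₀ b₁ b̄₁ d̄₁
                 d₂ ⟩
      b₁ * a₀ * b̄₀ * ā₁ * (b₀ * d₂ * (b̄₁ * d̄₁)) ∎
      where
      α< = ℕₚ.m≤n⇒m≤1+n α<r
      a₀ = ρ α n
      ā₁ = ρ̄ α (suc n)
      b₀ = ρ (suc α) n
      b̄₀ = ρ̄ (suc α) n
      b₁ = ρ (suc α) (suc n)
      b̄₁ = ρ̄ (suc α) (suc n)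
      b₂ = ρ (suc α) (suc (suc n))
      b̄₂ = ρ̄ (suc α) (suc (suc n))
      d̄₁ = ρ̄ (suc (suc α)) (suc n)
      d₂ = ρ (suc (suc α)) (suc (suc n))

    o-zero : ∀ n → o n 0 ≈ ρ 1 (suc n) * ρ̄ 1 n
    o-zero n = trans (*-cong (*-congʳ (*-congˡ (boundary₀ n))) (ρ̄₀ (suc n)))
      (solve 2 (λ x y → x :* con 1 :* y :* con 1 := x :* y) refl _ _)

    o-zero-s : ∀ n → o (suc n) 0 ≈ s n 0
    o-zero-s n = trans (o-zero (suc n)) (sym (trans
        (*-cong (*-congʳ (boundary₀ n)) (*-congʳ (ρ̄₀ (suc n))))
      (solve 2 (λ x y → con 1 :* x :* (con 1 :* y) := x :* y) refl _ _)))

    H : ℕ → S.Series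
    H n = continuedFraction (o n) (e n) r 0 1

    H-evolution : ∀ n → H n S.≈ S.1# S.+ S.t S.* (S.const (o (suc n) 0) S.* H (suc n))
    H-evolution n = Evolution.continuedFraction-evolution r (o n) (e n) (o (suc n)) (e (suc n))
        (s n) (s̄ n)
      (s-split n) (s-last n) (s-inverse n) (e-evolution n) (o-evolution n) (o-zero-s n)

    -- The ratio in the evolution turns the prefactor ρ 1 (n+1) into ρ 1 (n+2); hence n varies in
    -- the induction on k.
    ρ₁-continuedFraction : ∀ k n → ρ 1 (k ℕ.+ suc n) ≈ ρ 1 (suc n) * H n k
    ρ₁-continuedFraction zero n = sym (begin
      ρ 1 (suc n) * H n 0      ≈⟨ *-congˡ (S.at (H-evolution n) 0) ⟩
      ρ 1 (suc n) * (1# + (S.t S.* tailH) 0) ≈⟨ *-congˡ (+-congˡ (S.t-*-zero tailH)) ⟩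
      ρ 1 (suc n) * (1# + 0#)  ≈⟨ *-congˡ (+-identityʳ _) ⟩
      ρ 1 (suc n) * 1#         ≈⟨ *-identityʳ _ ⟩
      ρ 1 (suc n)              ∎)
      where
      tailH = S.const (o (suc n) 0) S.* H (suc n)
    ρ₁-continuedFraction (suc k) n = sym (begin
      x * H n (suc k)
        ≈⟨ *-congˡ (S.at (H-evolution n) (suc k)) ⟩
      x * (0# + (S.t S.* tailH) (suc k))
        ≈⟨ *-congˡ (trans (+-identityˡ _) (trans (S.t-*-suc tailH k)
            (S.const-* (o (suc n) 0) (H (suc n)) k))) ⟩
      x * (o (suc n) 0 * H (suc n) k)
        ≈⟨ *-congˡ (*-congʳ (o-zero (suc n))) ⟩
      x * (y * x̄ * H (suc n) k)
        ≈⟨ solve 4 (λ x y x̄ h → x :* (y :* x̄ :* h) := y :* h :* (x :* x̄)) refl x y x̄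
            (H (suc n) k) ⟩
      y * H (suc n) k * (x * x̄)
        ≈⟨ trans (*-congˡ (inverse 1 (suc n) (ℕ.s≤s ℕ.z≤n))) (*-identityʳ _) ⟩
      y * H (suc n) k
        ≈⟨ ρ₁-continuedFraction k (suc n) ⟨
      ρ 1 (k ℕ.+ suc (suc n))
        ≡⟨ ≡.cong (ρ 1) (ℕₚ.+-suc k (suc n)) ⟩
      ρ 1 (suc k ℕ.+ suc n) ∎)
      where
      tailH = S.const (o (suc n) 0) S.* H (suc n)
      x = ρ 1 (suc n)
      x̄ = ρ̄ 1 (suc n)
      y = ρ 1 (suc (suc n))

    private
      ρ₀ ρ̄₀′ ρ₁ ρ̄₁′ : ℕ → A
      ρ₀  α = ρ α 0
      ρ̄₀′ α = ρ̄ α 0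
      ρ₁  α = ρ α 1
      ρ̄₁′ α = ρ̄ α 1

    -- Since p_(2r+2) = 0 and the row r + 1 is 1, what remains is the power of the last odd weight
    -- that `pathWeight-∏` keeps outside its product.
    remainder-last : ∀ p → p (2 ℕ.+ r ℕ.* 2) ≡ 0 →
      remainder ρ₀ ρ̄₀′ ρ₁ ρ̄₁′ p r ≈ o 0 (r ℕ.+ 0) ^ p (1 ℕ.+ r ℕ.* 2)
    remainder-last p p-last = begin
      ρ r 0 ^ (p (2 ℕ.+ r ℕ.* 2) ℕ.+ k) * (ρ̄ (suc r) 1 ^ p (r ℕ.* 2) * ρ̄ r 1 ^ k)
        ≈⟨ *-cong (^-congʳ (ρ r 0) (≡.cong (ℕ._+ k) p-last))
            (trans (*-congʳ (one-^ (ρ̄₁ 1) (p (r ℕ.* 2)))) (*-identityˡ _)) ⟩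
      ρ r 0 ^ k * ρ̄ r 1 ^ k
        ≈⟨ ^-distrib-* (ρ r 0) (ρ̄ r 1) k ⟨
      (ρ r 0 * ρ̄ r 1) ^ k
        ≈⟨ ^-congˡ k (*-congʳ (trans (*-congʳ (trans (*-congʳ (boundary₁ 1)) (*-identityˡ _)))
             (trans (*-congˡ (ρ̄₁ 0)) (*-identityʳ _)))) ⟨
      o 0 r ^ k
        ≡⟨ ≡.cong (λ α → o 0 α ^ k) (ℕₚ.+-identityʳ r) ⟨
      o 0 (r ℕ.+ 0) ^ k ∎
      where
      k = p (1 ℕ.+ r ℕ.* 2)

    summand : (ℕ → ℕ) → A
    summand p = ∏ r (exponentFactor ρ₀ ρ̄₀′ ρ₁ ρ̄₁′ p) * fromℕ (trinomial 1 (p 1) (p 2))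
      * ∏ r (trinomialFactor p)

    summand-pathWeight : ∀ (v : Vec ℕ (suc (r ℕ.* 2))) → summand (entry v) ≈
        pathWeight (o 0) (e 0) 0 1 v
    summand-pathWeight v = begin
      summand p
        ≈⟨ *-congʳ (*-congʳ (∏-exponentFactor ρ₀ ρ̄₀′ ρ₁ ρ̄₁′ p ≡.refl (boundary₀ 0) (ρ̄₀ 1) r
            (λ j → inverse j 1))) ⟩
      M * remainder ρ₀ ρ̄₀′ ρ₁ ρ̄₁′ p r * B * N
        ≈⟨ *-congʳ (*-congʳ (*-congˡ (remainder-last p (entry-last v)))) ⟩
      M * o 0 (r ℕ.+ 0) ^ p (1 ℕ.+ r ℕ.* 2) * B * N
        ≈⟨ pathWeight-∏ (o 0) (e 0) r 0 1 v ⟨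
      pathWeight (o 0) (e 0) 0 1 v ∎
      where
      p = entry v
      M = ∏ r (monomial (o 0) (e 0) p 0)
      N = ∏ r (trinomialFactor p)
      B = fromℕ (trinomial 1 (p 1) (p 2))

    -- The length is a variable with an equation because 2r + 1 and the 1 + r · 2 of the recursion
    -- by pairs do not agree by computation.
    ρ₁-∑ : ∀ {k} → k ≡ suc (r ℕ.* 2) → ∀ n →
      ρ 1 (n ℕ.+ 1) ≈ ρ 1 1 * ∑ (compositions k n) (λ v → summand (entry v))
    ρ₁-∑ ≡.refl n = begin
      ρ 1 (n ℕ.+ 1)
        ≈⟨ ρ₁-continuedFraction n 0 ⟩
      ρ 1 1 * H 0 n
        ≈⟨ *-congˡ (∑-pathWeight (o 0) (e 0) r 0 1 n) ⟨
      ρ 1 1 * ∑ (compositions (suc (r ℕ.* 2)) n) (pathWeight (o 0) (e 0) 0 1)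
        ≈⟨ *-congˡ (∑-cong (compositions (suc (r ℕ.* 2)) n) summand-pathWeight) ⟨
      ρ 1 1 * ∑ (compositions (suc (r ℕ.* 2)) n) (λ v → summand (entry v)) ∎

-- Positive elements of ℚ, of polynomial rings and of fraction fields.

record PositiveCone (D : DiscreteDomain) : Set₁ where
  open DiscreteDomain D
  field
    Pos    : Carrier → Set
    resp   : ∀ {x y} → x ≈ y → Pos x → Pos y
    pos-+  : ∀ {x y} → Pos x → Pos y → Pos (x + y)
    pos-*  : ∀ {x y} → Pos x → Pos y → Pos (x * y)
    pos-1  : Pos 1#
    pos≉0  : ∀ {x} → Pos x → ¬ x ≈ 0#

ℚ-cone : PositiveCone ℚ-domain
ℚ-cone = record
  { Pos   = λ x → ℚ.0ℚ ℚ.< x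
  ; resp  = λ { ≡.refl 0<x → 0<x }
  ; pos-+ = ℚₚ.+-mono-<
  ; pos-* = λ {x} {y} 0<x 0<y →
      ℚₚ.positive⁻¹ (x ℚ.* y) {{ℚₚ.pos*pos⇒pos x {{ℚ.positive 0<x}} y {{ℚ.positive 0<y}}}}
  ; pos-1 = ℚₚ.positive⁻¹ ℚ.1ℚ
  ; pos≉0 = λ 0<x x≡0 → ℚₚ.<-irrefl (≡.sym x≡0) 0<x
  }

module PolynomialCone {D : DiscreteDomain} (cone : PositiveCone D) where
  private
    module D = DiscreteDomain D
    module Cone = PositiveCone cone
  open Polynomial D
  open Properties

  -- Reading from the constant term is insensitive to trailing zeros; the sign of the leading
  -- coefficient would require normalised lists.
  Pos : Poly → Set
  Pos []      = ⊥
  Pos (a ∷ p) = Cone.Pos a ⊎ (a D.≈ D.0# × Pos p)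

  pos≉0 : ∀ p → Pos p → ¬ p ≈ []
  pos≉0 (a ∷ p) (inj₁ a>0)         e = Cone.pos≉0 a>0 (at e 0)
  pos≉0 (a ∷ p) (inj₂ (a≈0 , p>0)) e = pos≉0 p p>0 (mk≈ λ k → at e (suc k))

  resp : ∀ p q → p ≈ q → Pos p → Pos q
  resp p       []      e p>0                = contradiction e (pos≉0 p p>0)
  resp (a ∷ p) (b ∷ q) e (inj₁ a>0)         = inj₁ (Cone.resp (head-≈ e) a>0)
  resp (a ∷ p) (b ∷ q) e (inj₂ (a≈0 , p>0)) =
    inj₂ (D.trans (D.sym (head-≈ e)) a≈0 , resp p q (tail-≈ e) p>0)

  pos-+ : ∀ p q → Pos p → Pos q → Pos (p + q)
  pos-+ (a ∷ p) (b ∷ q) (inj₁ a>0)         (inj₁ b>0)         = inj₁ (Cone.pos-+ a>0 b>0)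
  pos-+ (a ∷ p) (b ∷ q) (inj₁ a>0)         (inj₂ (b≈0 , _))   =
    inj₁ (Cone.resp (D.sym (D.trans (D.+-congˡ b≈0) (D.+-identityʳ a))) a>0)
  pos-+ (a ∷ p) (b ∷ q) (inj₂ (a≈0 , _))   (inj₁ b>0)         =
    inj₁ (Cone.resp (D.sym (D.trans (D.+-congʳ a≈0) (D.+-identityˡ b))) b>0)
  pos-+ (a ∷ p) (b ∷ q) (inj₂ (a≈0 , p>0)) (inj₂ (b≈0 , q>0)) =
    inj₂ (D.trans (D.+-cong a≈0 b≈0) (D.+-identityˡ D.0#) , pos-+ p q p>0 q>0)

  pos-* : ∀ p q → Pos p → Pos q → Pos (p * q)
  pos-* (a ∷ p) (b ∷ q) (inj₁ a>0) (inj₁ b>0) =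
    inj₁ (Cone.resp (D.sym (D.+-identityʳ _)) (Cone.pos-* a>0 b>0))
  pos-* (a ∷ p) (b ∷ q) (inj₁ a>0) (inj₂ (b≈0 , q>0)) =
    resp (shift ((a ∷ p) * q)) ((a ∷ p) * (b ∷ q))
      (sym (trans (*-∷ (a ∷ p) b q) (+-cong (·-zero (a ∷ p) b≈0) refl)))
      (inj₂ (D.refl , pos-* (a ∷ p) q (inj₁ a>0) q>0))
  pos-* (a ∷ p) (b ∷ q) (inj₂ (a≈0 , p>0)) q>0 =
    resp (shift (p * (b ∷ q))) ((a ∷ p) * (b ∷ q))
      (sym (+-cong (·-zero (b ∷ q) a≈0) refl))
      (inj₂ (D.refl , pos-* p (b ∷ q) p>0 q>0))

  polynomialCone : PositiveCone domain
  polynomialCone = record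
    { Pos   = Pos
    ; resp  = λ {p} {q} → resp p q
    ; pos-+ = λ {p} {q} → pos-+ p q
    ; pos-* = λ {p} {q} → pos-* p q
    ; pos-1 = inj₁ Cone.pos-1
    ; pos≉0 = λ {p} → pos≉0 p
    }

ℚ[_]-cone : ∀ m → PositiveCone ℚ[ m ]
ℚ[ zero  ]-cone = ℚ-cone
ℚ[ suc m ]-cone = PolynomialCone.polynomialCone ℚ[ m ]-cone

pos-indeterminate : ∀ {m} (i : Fin m) → PositiveCone.Pos ℚ[ m ]-cone (indeterminate i)
pos-indeterminate {suc m} zero    =
  inj₂ (DiscreteDomain.refl ℚ[ m ] , inj₁ (PositiveCone.pos-1 ℚ[ m ]-cone))
pos-indeterminate {suc m} (suc i) = inj₁ (pos-indeterminate i)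

module FractionCone {D : DiscreteDomain} (cone : PositiveCone D) where
  private
    module D = DiscreteDomain D
    module Cone = PositiveCone cone
  open FieldOfFractions D
  private module K = CommutativeRing commutativeRing
  open Algebra.Solver.Ring.NaturalCoefficients.Default D.commutativeSemiring
    using (solve; _:=_; _:+_; _:*_; con)

  open Units commutativeRing using (*-cancel-unit)

  -- A quotient of two negatives is positive too, so positive numerator and denominator are asked of
  -- some equal fraction.
  record Positive (x : Fraction) : Set where
    constructor positive
    field
      representative : Fraction
      num>0          : Cone.Pos (num representative)
      den>0          : Cone.Pos (den representative)
      ≈representative : x ≈ representative

  positive-resp : ∀ {x y} → x ≈ y → Positive x → Positive y
  positive-resp {x} {y} e (positive z n d x≈z) =
      positive z n d (K.trans {y} {x} {z} (K.sym {x} {y} e) x≈z)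

  positive-fromDomain : ∀ {a} → Cone.Pos a → Positive (fromDomain a)
  positive-fromDomain {a} a>0 = positive (fromDomain a) a>0 Cone.pos-1 K.refl

  positive-+ : ∀ {x y} → Positive x → Positive y → Positive (x + y)
  positive-+ (positive x′@(_ / _ [ _ ]) n d e) (positive y′@(_ / _ [ _ ]) n′ d′ e′) =
    positive (x′ + y′) (Cone.pos-+ (Cone.pos-* n d′) (Cone.pos-* n′ d)) (Cone.pos-* d d′)
        (K.+-cong e e′)

  positive-* : ∀ {x y} → Positive x → Positive y → Positive (x * y)
  positive-* (positive x′@(_ / _ [ _ ]) n d e) (positive y′@(_ / _ [ _ ]) n′ d′ e′) =
    positive (x′ * y′) (Cone.pos-* n n′) (Cone.pos-* d d′) (K.*-cong e e′)

  positive-inverse : ∀ {x} → Positive x → ∃ λ y → Positive y × x * y ≈ 1#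
  positive-inverse {x} (positive (a / b [ b≉0 ]) a>0 b>0 x≈a/b) =
    y , positive y b>0 a>0 K.refl ,
    K.trans (K.*-congʳ {y} {x} {a / b [ b≉0 ]} x≈a/b)
      (mk≈ (solve 2 (λ a b → (a :* b) :* con 1 := con 1 :* (b :* a)) D.refl a b))
    where
    y = b / a [ Cone.pos≉0 a>0 ]

  positive-divide : ∀ {x y} → Positive (x * y) → Positive y → Positive x
  positive-divide {x} {y} xy>0 y>0 = positive-resp {x * y * z} {x}
    (*-cancel-unit x y z (proj₂ (proj₂ inverse)))
    (positive-* {x * y} {z} xy>0 (proj₁ (proj₂ inverse)))
    where
    inverse = positive-inverse {y} y>0
    z       = proj₁ inverse

-- Integer exponents as pairs of natural exponents.

+-+--≡⊖ : ∀ a b c d → + a ℤ.+ + b ℤ.- + c ℤ.- + d ≡ (a ℕ.+ b) ⊖ (c ℕ.+ d)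
+-+--≡⊖ a b c d = begin
  + (a ℕ.+ b) ℤ.- + c ℤ.- + d              ≡⟨ ℤₚ.+-assoc (+ (a ℕ.+ b)) (ℤ.- + c) (ℤ.- + d) ⟩
  + (a ℕ.+ b) ℤ.+ (ℤ.- + c ℤ.- + d)        ≡⟨
      ≡.cong (λ z → + (a ℕ.+ b) ℤ.+ z) (ℤₚ.neg-distrib-+ (+ c) (+ d)) ⟨
  + (a ℕ.+ b) ℤ.- + (c ℕ.+ d)              ≡⟨ ℤₚ.[+m]-[+n]≡m⊖n (a ℕ.+ b) (c ℕ.+ d) ⟩
  (a ℕ.+ b) ⊖ (c ℕ.+ d)                    ∎
  where open ≡.≡-Reasoning

module FractionPowers (D : DiscreteDomain) where
  private module D = DiscreteDomain D
  open FieldOfFractions D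
  private module K = CommutativeRing commutativeRing
  open Algebra.Properties.CommutativeSemiring.Exp K.commutativeSemiring using (^-homo-*)
  open Algebra.Solver.Ring.NaturalCoefficients.Default K.commutativeSemiring
    using (solve; _:=_; _:+_; _:*_; con)
  open Telescoping commutativeRing using (^-inverse)
  open Relation.Binary.Reasoning.Setoid K.setoid

  unit≉0 : ∀ {x y} → x * y ≈ 1# → ¬ x ≈ 0#
  unit≉0 {x} {y} xy≈1 x≈0 = D.1≉0 (D.trans (D.sym (D.*-identityʳ _))
    (D.trans (cross (K.trans (K.sym xy≈1) (K.trans (K.*-congʳ {y} x≈0) (K.zeroˡ y)))) (D.zeroˡ _)))

  -- Some inverse excludes x ≈ 0, the case in which `_⁻¹` returns 0.
  unit-⁻¹ : ∀ {x y} → x * y ≈ 1# → x * x ⁻¹ ≈ 1#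
  unit-⁻¹ {x} {y} e = ⁻¹-inverseʳ x (unit≉0 {x} {y} e)

  ⁻¹-unique : ∀ {x y} → x * y ≈ 1# → x ⁻¹ ≈ y
  ⁻¹-unique {x} {y} e = begin
    x ⁻¹           ≈⟨ K.*-identityʳ (x ⁻¹) ⟨
    x ⁻¹ * 1#      ≈⟨ K.*-congˡ {x ⁻¹} e ⟨
    x ⁻¹ * (x * y) ≈⟨ solve 3 (λ x y z → z :* (x :* y) := y :* (x :* z)) K.refl x y (x ⁻¹) ⟩
    y * (x * x ⁻¹) ≈⟨ K.*-congˡ {y} (unit-⁻¹ {x} {y} e) ⟩
    y * 1#         ≈⟨ K.*-identityʳ y ⟩
    y              ∎

  module _ {x y : Fraction} (xy≈1 : x * y ≈ 1#) where

    ^ᶻ-⊖ : ∀ m n → x ^ᶻ (m ⊖ n) ≈ x ^ m * y ^ n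
    ^ᶻ-⊖ m       zero    = K.sym (K.*-identityʳ (x ^ m))
    ^ᶻ-⊖ zero    (suc n) = K.trans (⁻¹-unique {x ^ suc n} {y ^ suc n} (^-inverse xy≈1 (suc n)))
        (K.sym (K.*-identityˡ (y ^ suc n)))
    ^ᶻ-⊖ (suc m) (suc n) = begin
      x ^ᶻ (suc m ⊖ suc n)      ≡⟨ ≡.cong (x ^ᶻ_) (ℤₚ.[1+m]⊖[1+n]≡m⊖n m n) ⟩
      x ^ᶻ (m ⊖ n)              ≈⟨ ^ᶻ-⊖ m n ⟩
      x ^ m * y ^ n             ≈⟨ K.*-identityʳ _ ⟨
      x ^ m * y ^ n * 1#        ≈⟨ K.*-congˡ {x ^ m * y ^ n} xy≈1 ⟨
      x ^ m * y ^ n * (x * y)   ≈⟨ solve 4 (λ p q x y → p :* q :* (x :* y) := (x :* p) :* (y :* q))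
          K.refl (x ^ m) (y ^ n) x y ⟩
      x ^ suc m * y ^ suc n     ∎

    ^ᶻ-⊖-⁻¹ : ∀ m n → (x ^ᶻ (m ⊖ n)) ⁻¹ ≈ x ^ n * y ^ m
    ^ᶻ-⊖-⁻¹ m n = ⁻¹-unique {x ^ᶻ (m ⊖ n)} {x ^ n * y ^ m} (begin
      x ^ᶻ (m ⊖ n) * (x ^ n * y ^ m)     ≈⟨ K.*-congʳ {x ^ n * y ^ m} (^ᶻ-⊖ m n) ⟩
      x ^ m * y ^ n * (x ^ n * y ^ m)    ≈⟨ solve 4
          (λ a b c d → a :* b :* (c :* d) := a :* d :* (c :* b)) K.refl (x ^ m) (y ^ n) (x ^ n)
              (y ^ m) ⟩
      x ^ m * y ^ m * (x ^ n * y ^ n)    ≈⟨ K.*-cong (^-inverse xy≈1 m) (^-inverse xy≈1 n) ⟩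
      1# * 1#                            ≈⟨ K.*-identityˡ 1# ⟩
      1#                                 ∎)

  power-quotient : ∀ {x x̄ y ȳ} → x * x̄ ≈ 1# → y * ȳ ≈ 1# → ∀ a b c d a′ b′ c′ d′ →
    x ^ᶻ (+ a ℤ.+ + b ℤ.- + c ℤ.- + d) * (y ^ᶻ (+ a′ ℤ.+ + b′ ℤ.- + c′ ℤ.- + d′)) ⁻¹ ≈
      x ^ (a ℕ.+ b) * x̄ ^ (c ℕ.+ d) * (y ^ (c′ ℕ.+ d′) * ȳ ^ (a′ ℕ.+ b′))
  power-quotient {x} {x̄} {y} {ȳ} xx̄≈1 yȳ≈1 a b c d a′ b′ c′ d′ = begin
    x ^ᶻ (+ a ℤ.+ + b ℤ.- + c ℤ.- + d) * (y ^ᶻ (+ a′ ℤ.+ + b′ ℤ.- + c′ ℤ.- + d′)) ⁻¹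
      ≡⟨ ≡.cong₂ (λ m n → x ^ᶻ m * (y ^ᶻ n) ⁻¹) (+-+--≡⊖ a b c d) (+-+--≡⊖ a′ b′ c′ d′) ⟩
    x ^ᶻ (m ⊖ n) * (y ^ᶻ (m′ ⊖ n′)) ⁻¹
      ≈⟨ K.*-cong {x ^ᶻ (m ⊖ n)} {x ^ m * x̄ ^ n} {(y ^ᶻ (m′ ⊖ n′)) ⁻¹} {y ^ n′ * ȳ ^ m′}
           (^ᶻ-⊖ {x} {x̄} xx̄≈1 m n) (^ᶻ-⊖-⁻¹ {y} {ȳ} yȳ≈1 m′ n′) ⟩
    x ^ m * x̄ ^ n * (y ^ n′ * ȳ ^ m′) ∎
    where
    m  = a ℕ.+ b
    n  = c ℕ.+ d
    m′ = a′ ℕ.+ b′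
    n′ = c′ ℕ.+ d′

-- The formula over the field of rational functions.

module Solution (r : ℕ) (R : ℕ → ℤ → QSystem.K r) (solution : QSystem.IsSolution r R) where
  open QSystem r
  open IsSolution solution
  private
    module K = CommutativeRing commutativeRing
    module Cone = FractionCone ℚ[ r ℕ.+ r ]-cone
    module Powers = FractionPowers ℚ[ r ℕ.+ r ]
    module Sums = FiniteSums commutativeRing

  ρ ρ̄ : ℕ → ℕ → K
  ρ α n = R α (+ n)
  ρ̄ α n = ρ α n ⁻¹

  ρ-boundary₁ : ∀ n → ρ (suc r) n ≈ 1#
  ρ-boundary₁ n = ≡.subst (λ α → R α (+ n) ≈ 1#) (ℕₚ.+-comm r 1) (boundary₁ (+ n))

  ρ-recursion : ∀ α n → α < r → ρ (suc α) (2 ℕ.+ n) * ρ (suc α) n ≈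
    ρ (suc α) (1 ℕ.+ n) * ρ (suc α) (1 ℕ.+ n) + ρ (2 ℕ.+ α) (1 ℕ.+ n) * ρ α (1 ℕ.+ n)
  ρ-recursion α n α<r = begin
    ρ (suc α) (2 ℕ.+ n) * ρ (suc α) n
      ≡⟨ ≡.cong (λ m → R (suc α) (+ m) * ρ (suc α) n) (ℕₚ.+-comm 1 (suc n)) ⟩
    R (suc α) (+ suc n ℤ.+ 1ℤ) * R (suc α) (+ suc n ℤ.- 1ℤ)
      ≈⟨ recursion (suc α) (+ suc n) (ℕ.s≤s ℕ.z≤n) α<r ⟩
    x ^ 2 + R (suc α ℕ.+ 1) (+ suc n) * ρ α (suc n)
      ≡⟨ ≡.cong (λ β → x ^ 2 + R β (+ suc n) * ρ α (suc n)) (ℕₚ.+-comm (suc α) 1) ⟩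
    x ^ 2 + y
      ≈⟨ K.+-congʳ {y} {x ^ 2} {x * x} (K.*-congˡ {x} {x * 1#} {x} (K.*-identityʳ x)) ⟩
    x * x + y ∎
    where
    open Relation.Binary.Reasoning.Setoid K.setoid
    x y : K
    x = ρ (suc α) (suc n)
    y = ρ (2 ℕ.+ α) (suc n) * ρ α (suc n)

  -- Positivity supplies an explicit inverse, which is then traded for the total `_⁻¹`.
  ρ-inverse : ∀ α n → α ≤ suc r → ρ α n * ρ̄ α n ≈ 1#
  ρ-inverse α n α≤ = Powers.unit-⁻¹ {ρ α n} {proj₁ inverse} (proj₂ (proj₂ inverse))
    where
    open PositiveQSystem.Solutions commutativeRing Cone.Positive
      (λ {x} {y} → Cone.positive-resp {x} {y})
      (Cone.positive-fromDomain (PositiveCone.pos-1 ℚ[ r ℕ.+ r ]-cone))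
      (λ {x} {y} → Cone.positive-+ {x} {y})
      (λ {x} {y} → Cone.positive-* {x} {y})
      (λ {x} {y} → Cone.positive-divide {x} {y})
      r ρ
      (λ i → Cone.positive-resp {init₀ i} {ρ (suc (toℕ i)) 0} (K.sym (initial₀ i))
        (Cone.positive-fromDomain (pos-indeterminate (i ↑ˡ r))))
      (λ i → Cone.positive-resp {init₁ i} {ρ (suc (toℕ i)) 1} (K.sym (initial₁ i))
        (Cone.positive-fromDomain (pos-indeterminate (r ↑ʳ i))))
      (λ n → boundary₀ (+ n)) ρ-boundary₁ ρ-recursion
    inverse = Cone.positive-inverse {ρ α n} (positive-ρ n α α≤)

  -- The two products are separate recursions, both stuck at a variable bound, so they are matched
  -- by induction.
  ∏-cong : ∀ m {f g} → (∀ i → i < m → f (suc i) ≈ g (suc i)) → ∏ m f ≈ Sums.∏ m g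
  ∏-cong zero            e = K.refl {1#}
  ∏-cong (suc m) {f} {g} e = K.*-cong {∏ m f} {Sums.∏ m g} {f (suc m)} {g (suc m)}
    (∏-cong m (λ i i<m → e i (ℕₚ.m<n⇒m<1+n i<m))) (e m (ℕₚ.n<1+n m))

  private
    module Q = InvertibleQSystem commutativeRing
    module T = Telescoping commutativeRing
    module W = CompositionSums commutativeRing

  numeratorFactor : (ℕ → ℕ) → ℕ → K
  numeratorFactor p = T.exponentFactor (λ α → ρ α 0) (λ α → ρ̄ α 0) (λ α → ρ α 1) (λ α → ρ̄ α 1) p

  -- The indices 2i, 2i + 2 and 2i + 1 are arguments so that each can be rewritten by congruence.
  quotient : (ℕ → ℕ) → ℕ → ℕ → ℕ → ℕ → K
  quotient p i j j₂ j₁ =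
    (R i (+ 0) ^ᶻ (+ p j₂ ℤ.+ + p j₁ ℤ.- + p j ℤ.- + p (j ℕ.∸ 1)))
    ÷ (R i (+ 1) ^ᶻ (+ p j₁ ℤ.+ + p j ℤ.- + p (j ℕ.∸ 1) ℤ.- + p (j ℕ.∸ 2)))

  quotient-exponentFactor : ∀ p i → i ≤ suc r →
    quotient p i (2 ℕ.* i) (2 ℕ.* i ℕ.+ 2) (2 ℕ.* i ℕ.+ 1) ≈ numeratorFactor p i
  quotient-exponentFactor p i i≤ = begin
    quotient p i (2 ℕ.* i) (2 ℕ.* i ℕ.+ 2) (2 ℕ.* i ℕ.+ 1)
      ≡⟨ ≡.cong (λ j → quotient p i j (j ℕ.+ 2) (j ℕ.+ 1)) (ℕₚ.*-comm 2 i) ⟩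
    quotient p i j (j ℕ.+ 2) (j ℕ.+ 1)
      ≡⟨ ≡.cong₂ (quotient p i j) (ℕₚ.+-comm j 2) (ℕₚ.+-comm j 1) ⟩
    quotient p i j (2 ℕ.+ j) (1 ℕ.+ j)
      ≈⟨ Powers.power-quotient {ρ i 0} {ρ̄ i 0} {ρ i 1} {ρ̄ i 1} (ρ-inverse i 0 i≤)
          (ρ-inverse i 1 i≤)
           (p (2 ℕ.+ j)) (p (1 ℕ.+ j)) (p j) (p (j ℕ.∸ 1)) (p (1 ℕ.+ j)) (p j) (p (j ℕ.∸ 1))
               (p (j ℕ.∸ 2)) ⟩
    numeratorFactor p i ∎
    where
    open Relation.Binary.Reasoning.Setoid K.setoid
    j = i ℕ.* 2

  C-trinomialFactor : ∀ (p : ℕ → ℕ) i →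
    C (p (2 ℕ.* i)) (p (2 ℕ.* i ℕ.+ 1)) (p (2 ℕ.* i ℕ.+ 2)) ≡
      trinomial (p (i ℕ.* 2)) (p (1 ℕ.+ i ℕ.* 2)) (p (2 ℕ.+ i ℕ.* 2))
  C-trinomialFactor p i = begin
    C (p (2 ℕ.* i)) (p (2 ℕ.* i ℕ.+ 1)) (p (2 ℕ.* i ℕ.+ 2))
      ≡⟨ ≡.cong (λ j → C (p j) (p (j ℕ.+ 1)) (p (j ℕ.+ 2))) (ℕₚ.*-comm 2 i) ⟩
    C (p j) (p (j ℕ.+ 1)) (p (j ℕ.+ 2))
      ≡⟨ ≡.cong₂ (λ j₁ j₂ → C (p j) (p j₁) (p j₂)) (ℕₚ.+-comm j 1) (ℕₚ.+-comm j 2) ⟩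
    C (p j) (p (1 ℕ.+ j)) (p (2 ℕ.+ j))
      ≡⟨ C≡trinomial (p j) (p (1 ℕ.+ j)) (p (2 ℕ.+ j)) ⟩
    trinomial (p j) (p (1 ℕ.+ j)) (p (2 ℕ.+ j)) ∎
    where
    open ≡.≡-Reasoning
    j = i ℕ.* 2

  summand : (ℕ → ℕ) → K
  summand p =
    ∏ r (λ i → quotient p i (2 ℕ.* i) (2 ℕ.* i ℕ.+ 2) (2 ℕ.* i ℕ.+ 1))
    * fromℕ (binomial (p 1 ℕ.+ p 2) (p 1))
    * ∏ r (λ ℓ → fromℕ (C (p (2 ℕ.* ℓ)) (p (2 ℕ.* ℓ ℕ.+ 1)) (p (2 ℕ.* ℓ ℕ.+ 2))))

  summand≈ : ∀ p → summand p ≈ Q.summand r ρ ρ̄ ρ-inverse (λ n → boundary₀ (+ n)) ρ-boundary₁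
      ρ-recursion p
  summand≈ p = K.*-cong {X * B} {X′ * B′} {N} {N′}
    (K.*-cong {X} {X′} {B} {B′}
      (∏-cong r λ i i<r → quotient-exponentFactor p (suc i) (ℕₚ.m≤n⇒m≤1+n i<r))
      (K.reflexive (≡.cong fromℕ (≡.trans (binomial≡C (p 1) (p 2)) (C≡trinomial 1 (p 1) (p 2))))))
    (∏-cong r λ i _ → K.reflexive (≡.cong fromℕ (C-trinomialFactor p (suc i))))
    where
    X X′ B B′ N N′ : K
    X = ∏ r (λ i → quotient p i (2 ℕ.* i) (2 ℕ.* i ℕ.+ 2) (2 ℕ.* i ℕ.+ 1))
    X′ = Sums.∏ r (numeratorFactor p)
    B = fromℕ (binomial (p 1 ℕ.+ p 2) (p 1))
    B′ = W.fromℕ (trinomial 1 (p 1) (p 2))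
    N = ∏ r (λ ℓ → fromℕ (C (p (2 ℕ.* ℓ)) (p (2 ℕ.* ℓ ℕ.+ 1)) (p (2 ℕ.* ℓ ℕ.+ 2))))
    N′ = Sums.∏ r (λ i → fromℕ (trinomial (p (i ℕ.* 2)) (p (1 ℕ.+ i ℕ.* 2)) (p (2 ℕ.+ i ℕ.* 2))))

  R₁-∑ : ∀ n → R 1 (+ (n ℕ.+ 1)) ≈ R 1 1ℤ * ∑ (compositions (2 ℕ.* r ℕ.+ 1) n)
      (λ v → summand (entry v))
  R₁-∑ n = begin
    ρ 1 (n ℕ.+ 1)
      ≈⟨ Q.ρ₁-∑ r ρ ρ̄ ρ-inverse (λ n → boundary₀ (+ n)) ρ-boundary₁ ρ-recursion
           (≡.trans (ℕₚ.+-comm (2 ℕ.* r) 1) (≡.cong suc (ℕₚ.*-comm 2 r))) n ⟩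
    ρ 1 1 * ∑ vs (λ v → Σ′ (entry v))
      ≈⟨ K.*-congˡ {ρ 1 1} {∑ vs (λ v → summand (entry v))} {∑ vs (λ v → Σ′ (entry v))}
           (Sums.∑-cong vs {λ v → summand (entry v)} {λ v → Σ′ (entry v)}
               (λ v → summand≈ (entry v))) ⟨
    ρ 1 1 * ∑ vs (λ v → summand (entry v)) ∎
    where
    open Relation.Binary.Reasoning.Setoid K.setoid
    vs = compositions (2 ℕ.* r ℕ.+ 1) n
    Σ′ : (ℕ → ℕ) → K
    Σ′ = Q.summand r ρ ρ̄ ρ-inverse (λ n → boundary₀ (+ n)) ρ-boundary₁ ρ-recursion

mainTheorem3 : (r : ℕ) → 1 ≤ r →
  let open QSystem r in
  (R : ℕ → ℤ → K) → IsSolution R →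
  (n : ℕ) →
  R 1 (+ (n ℕ.+ 1)) ≈
    R 1 1ℤ * ∑ (compositions (2 ℕ.* r ℕ.+ 1) n) (λ v →
      let p = entry v
          pᶻ = λ j → + p j
      in
      ∏ r (λ i →
        (R i (+ 0) ^ᶻ (pᶻ (2 ℕ.* i ℕ.+ 2) ℤ.+ pᶻ (2 ℕ.* i ℕ.+ 1) ℤ.- pᶻ (2 ℕ.* i) ℤ.- pᶻ (2 ℕ.* i ℕ.∸ 1)))
        ÷ (R i (+ 1) ^ᶻ (pᶻ (2 ℕ.* i ℕ.+ 1) ℤ.+ pᶻ (2 ℕ.* i) ℤ.- pᶻ (2 ℕ.* i ℕ.∸ 1) ℤ.- pᶻ (2 ℕ.* i ℕ.∸ 2))))
      * fromℕ (binomial (p 1 ℕ.+ p 2) (p 1))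
      * ∏ r (λ ℓ → fromℕ (C (p (2 ℕ.* ℓ)) (p (2 ℕ.* ℓ ℕ.+ 1)) (p (2 ℕ.* ℓ ℕ.+ 2)))))
mainTheorem3 r 1≤r R solution n = Solution.R₁-∑ r R solution n
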